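{- Consider the variant of the firefighter process in which $4$ firefighters are available at the first step and $3$ firefighters at each subsequent step. Then for every planar graph $G$ with at least two vertices, $\frac{1}{n^2}\sum_{v\in V(G)} s(G,v)\ge 1/2712$, where $n=|V(G)|$ and $s(G,v)$ is the maximum number of vertices of $G$ that can be saved in this variant when the fire starts at $v$.
   Context: Firefighter process (variant): in a finite simple graph $G$, a fire starts at time $0$ at a vertex $v$. At time step $1$ the firefighters protect at most $4$ non-burning vertices, and at each later time step they protect at most $3$ non-burning vertices (protection is permanent); after the protection in each step, the fire spreads from every burning vertex to all its unprotected neighbours. A vertex is saved if it never burns. The quantity $\frac{1}{n^2}\sum_{v} s(G,v)$ is the surviving rate of $G$ in this variant. -}

module Defs where

open import Algebra.Properties.CommutativeMonoid.Sum using (sum)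
open import Data.Fin.Base using (Fin; toℕ; zero; suc)
open import Data.Fin.Properties as Fin using (any?; all?)
open import Data.Fin.Subset using (Subset; _∈_; ⊥; ∣_∣)
open import Data.Fin.Subset.Properties
  using (_∈?_; ∉⊥; ∣⊥∣≡0; ∣p∣≤n; p⊂q⇒∣p∣<∣q∣; x∈p⇒∣p-x∣<∣p∣; anySubset?)
import Data.Integer.Base as ℤ
open import Data.Nat.Base
  using (ℕ; zero; suc; _+_; _∸_; _*_; _^_; _≤_; _<_; z≤n; s≤s; NonZero)
open import Data.Nat.GeneralisedArithmetic using (iterate)
open import Data.Nat.Properties
  using ( +-0-commutativeMonoid; m^n≢0; _≟_; _≤?_; _<?_; anyUpTo?; allUpTo?
        ; ≤-trans; <-≤-trans; ≤-<-trans; <-irrefl; ≤-total; m≤n⇒m≤1+n; <⇒≤; ≮⇒≥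
        ; m≤n⇒m<n∨m≡n; m∸n+n≡m)
open import Data.Product.Base using (∃; Σ-syntax; ∃-syntax; _×_; _,_; proj₁; proj₂)
open import Data.Rational.Base as ℚ using (ℚ)
open import Data.Sum.Base using (_⊎_; inj₁; inj₂)
open import Data.Vec.Base using (Vec; []; _∷_; tabulate)
open import Data.Vec.Properties using ([]=⇒lookup; lookup⇒[]=; lookup∘tabulate)
open import Function.Base using (_∘_)
open import Function.Bundles using (_↔_; _⇔_; Inverse)
open import Function.Definitions using (Surjective)
open import Level using (0ℓ)
open import Relation.Binary.Construct.Closure.ReflexiveTransitive using (Star)
open import Relation.Binary.Core using (Rel)
import Relation.Binary.Definitions as B
open import Relation.Binary.PropositionalEquality
  using (_≡_; refl; sym; trans; subst)
open import Relation.Nullary using (¬_; Dec; yes; no; does; contradiction)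
open import Relation.Nullary.Decidable
  using (map′; _×-dec_; _⊎-dec_; _→-dec_; ¬?; dec-true)
open import Relation.Unary using (Pred; Decidable)

record Graph (n : ℕ) : Set₁ where
  field
    Adj    : Rel (Fin n) 0ℓ
    adj?   : B.Decidable Adj
    symm   : B.Symmetric Adj
    irrefl : B.Irreflexive _≡_ Adj

  Connected : Rel (Fin n) 0ℓ
  Connected = Star Adj

-- The number of classes of the equivalence relation _≈_ is k.
record ClassCount {A : Set} (_≈_ : Rel A 0ℓ) (k : ℕ) : Set where
  field
    class      : A → Fin k
    surjective : Surjective _≡_ _≡_ class
    class-≡    : ∀ {x y} → class x ≡ class y ⇔ x ≈ y

-- For a permutation of a finite set forward iteration already gives an
-- equivalence relation.
SameOrbit : {A : Set} → (A → A) → Rel A 0ℓ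
SameOrbit f x y = ∃[ k ] iterate f x k ≡ y

module _ {n} (G : Graph n) where
  open Graph G

  -- An edge with a direction; adjacency is irrelevant so that a dart is
  -- determined by its two ends.
  record Dart : Set where
    constructor dart
    field
      tail head : Fin n
      .adjacent : Adj tail head

  open Dart

  reverse : Dart → Dart
  reverse (dart u v uv) = dart v u (symm uv)

  -- A rotation system: a cyclic order of the darts leaving each vertex.
  record RotationSystem : Set where
    field
      rotation : Dart ↔ Dart

    next : Dart → Dart
    next = Inverse.to rotation

    field
      cyclic : ∀ {d e} → SameOrbit next d e ⇔ tail d ≡ tail e

    -- The orbits are the boundary walks of the faces.
    faceStep : Dart → Dart
    faceStep = next ∘ reverse

  -- Every component with an edge is cellularly embedded, by the rotation
  -- system, in a closed orientable surface of its own, where V - E + F ≤ 2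
  -- with equality exactly for the sphere.  Hence the sum V + F = E + 2C over
  -- these components says that each of them is drawn on the sphere.  Isolated
  -- vertices have no darts, so they are counted in neither V nor C.
  record IsSpherical (R : RotationSystem) : Set where
    open RotationSystem R
    field
      V E F C    : ℕ
      vertices   : ClassCount (λ d e → tail d ≡ tail e) V
      edges      : ClassCount (SameOrbit reverse) E
      faces      : ClassCount (SameOrbit faceStep) F
      components : ClassCount (λ d e → Connected (tail d) (tail e)) C
      euler      : V + F ≡ E + 2 * C

  Planar : Set
  Planar = Σ[ R ∈ RotationSystem ] IsSpherical R

firefighters : ℕ → ℕ
firefighters zero    = 4
firefighters (suc _) = 3

-- The t-th set is the one protected at time step t + 1.
Strategy : ℕ → Set
Strategy n = ℕ → Subset n

Protected : ∀ {n} → Strategy n → ℕ → Fin n → Set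
Protected P t u = ∃[ i ] i < t × u ∈ P i

module _ {n} (G : Graph n) (v : Fin n) where
  open Graph G

  data Burning (P : Strategy n) : ℕ → Fin n → Set where
    start  : Burning P 0 v
    stay   : ∀ {t u} → Burning P t u → Burning P (suc t) u
    spread : ∀ {t w u} → Burning P t w → Adj w u → ¬ Protected P (suc t) u →
             Burning P (suc t) u

  LegalStep : Strategy n → ℕ → Set
  LegalStep P t = ∣ P t ∣ ≤ firefighters t × (∀ u → u ∈ P t → ¬ Burning P t u)

  -- Some legal strategy saves a set of k vertices, and possibly more.
  record CanSave (k : ℕ) : Set where
    field
      strategy : Strategy n
      legal    : ∀ t → LegalStep strategy t
      saved    : Subset n
      size     : ∣ saved ∣ ≡ k
      safe     : ∀ u → u ∈ saved → ∀ t → ¬ Burning strategy t u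

  -- CanSave is decidable: the fire no longer spreads after n steps, so only
  -- the first n sets of a strategy matter.

  private
    protected? : ∀ (P : Strategy n) t → Decidable (Protected P t)
    protected? P t u = anyUpTo? (λ i → u ∈? P i) t

    burning? : ∀ P t → Decidable (Burning P t)
    burning? P zero u = map′ (λ { refl → start }) (λ { start → refl })
      (v Fin.≟ u)
    burning? P (suc t) u = map′ to from
      (burning? P t u ⊎-dec
       any? (λ w → burning? P t w ×-dec adj? w u ×-dec ¬? (protected? P (suc t) u)))
      where
      to : _ → _
      to (inj₁ b)                = stay b
      to (inj₂ (_ , b , a , ¬p)) = spread b a ¬p
      from : Burning P (suc t) u → _
      from (stay b)        = inj₁ b
      from (spread b a ¬p) = inj₂ (_ , b , a , ¬p)

    stay* : ∀ {P t u} m → Burning P t u → Burning P (m + t) u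
    stay* zero    b = b
    stay* (suc m) b = stay (stay* m b)

    local : ∀ {P Q} t {u} → (∀ {i} → i < t → P i ≡ Q i) →
            Burning P t u → Burning Q t u
    local zero    eq start = start
    local (suc t) eq (stay b) = stay (local t (eq ∘ m≤n⇒m≤1+n) b)
    local (suc t) eq (spread b a ¬p) = spread (local t (eq ∘ m≤n⇒m≤1+n) b) a
      λ { (i , i<t , u∈) → ¬p (i , i<t , subst (_ ∈_) (sym (eq i<t)) u∈) }

    Stable : Strategy n → ℕ → Set
    Stable P t = ∀ u → Burning P (suc t) u → Burning P t u

    stable-suc : ∀ {P t} → Stable P t → Stable P (suc t)
    stable-suc st u (stay b) = b
    stable-suc st u (spread b a ¬p) =
      spread (st _ b) a λ { (i , i<t , u∈) → ¬p (i , m≤n⇒m≤1+n i<t , u∈) }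

    stable-+ : ∀ {P t} m → Stable P t → Stable P (m + t)
    stable-+ zero    st = st
    stable-+ (suc m) st = stable-suc (stable-+ m st)

    unstay* : ∀ {P t u} m → Stable P t → Burning P (m + t) u → Burning P t u
    unstay* zero    st b = b
    unstay* (suc m) st b = unstay* m st (stable-+ m st _ b)

    burnt : Strategy n → ℕ → Subset n
    burnt P t = tabulate (λ u → does (burning? P t u))

    ∈burnt⁺ : ∀ {P t u} → Burning P t u → u ∈ burnt P t
    ∈burnt⁺ {P} {t} {u} b = lookup⇒[]= u (burnt P t)
      (trans (lookup∘tabulate _ u) (dec-true (burning? P t u) b))

    ∈burnt⁻ : ∀ {P t u} → u ∈ burnt P t → Burning P t u
    ∈burnt⁻ {P} {t} {u} u∈ with burning? P t u
      | trans (sym (lookup∘tabulate (λ u → does (burning? P t u)) u))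
              ([]=⇒lookup u∈)
    ... | yes b | _  = b
    ... | no  _ | ()

    grows : ∀ P t → Stable P t ⊎ t < ∣ burnt P t ∣
    grows P zero = inj₂ (≤-<-trans z≤n
      (x∈p⇒∣p-x∣<∣p∣ (∈burnt⁺ {P} {0} start)))
    grows P (suc t) with grows P t
    ... | inj₁ st = inj₁ (stable-suc st)
    ... | inj₂ t< with any? (λ u → burning? P (suc t) u ×-dec ¬? (burning? P t u))
    ...   | yes (u , b , ¬b) = inj₂ (≤-<-trans t< (p⊂q⇒∣p∣<∣q∣
              ( (∈burnt⁺ ∘ stay ∘ ∈burnt⁻) , u , ∈burnt⁺ b , (¬b ∘ ∈burnt⁻) )))
    ...   | no ¬new = inj₁ (stable-suc st)
      where
      st : Stable P t
      st u b with burning? P t u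
      ... | yes b′ = b′
      ... | no ¬b  = contradiction (u , b , ¬b) ¬new

    stable-n : ∀ P → Stable P n
    stable-n P with grows P n
    ... | inj₁ st = st
    ... | inj₂ n< = contradiction (<-≤-trans n< (∣p∣≤n (burnt P n))) (<-irrefl refl)

    within-n : ∀ {P u} t → Burning P t u → Burning P n u
    within-n {P} {u} t b with ≤-total t n
    ... | inj₁ t≤n = subst (λ s → Burning P s u) (m∸n+n≡m t≤n) (stay* (n ∸ t) b)
    ... | inj₂ n≤t = unstay* (t ∸ n) (stable-n P)
      (subst (λ s → Burning P s u) (sym (m∸n+n≡m n≤t)) b)

    pad : ∀ {m} → Vec (Subset n) m → Strategy n
    pad []       _       = ⊥
    pad (p ∷ ps) zero    = p
    pad (p ∷ ps) (suc t) = pad ps t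

    pad-tabulate : ∀ m (P : Strategy n) {i} → i < m →
                   P i ≡ pad {m} (tabulate (P ∘ toℕ)) i
    pad-tabulate (suc m) P {zero}  _         = refl
    pad-tabulate (suc m) P {suc i} (s≤s i<m) = pad-tabulate m (P ∘ suc) i<m

    pad-⊥ : ∀ {m} (ps : Vec (Subset n) m) {i} → m ≤ i → pad ps i ≡ ⊥
    pad-⊥ []       _         = refl
    pad-⊥ (p ∷ ps) (s≤s m≤i) = pad-⊥ ps m≤i

    anyVec? : ∀ {m} {Q : Pred (Vec (Subset n) m) 0ℓ} → Decidable Q → Dec (∃ Q)
    anyVec? {zero}  Q? = map′ ([] ,_) (λ { ([] , q) → q }) (Q? [])
    anyVec? {suc m} Q? =
      map′ (λ { (p , ps , q) → p ∷ ps , q }) (λ { (p ∷ ps , q) → p , ps , q })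
        (anySubset? (λ p → anyVec? (λ ps → Q? (p ∷ ps))))

    legalStep? : ∀ P → Decidable (LegalStep P)
    legalStep? P t = ∣ P t ∣ ≤? firefighters t ×-dec
      all? (λ u → u ∈? P t →-dec ¬? (burning? P t u))

    Saves : ℕ → Vec (Subset n) n → Set
    Saves k ps = (∀ {t} → t < n → LegalStep (pad ps) t) ×
      ∃[ S ] ∣ S ∣ ≡ k × (∀ u → u ∈ S → ¬ Burning (pad ps) n u)

    saves? : ∀ k → Decidable (Saves k)
    saves? k ps = allUpTo? (legalStep? (pad ps)) n ×-dec
      anySubset? (λ S → ∣ S ∣ ≟ k ×-dec
        all? (λ u → u ∈? S →-dec ¬? (burning? (pad ps) n u)))

    saves⇒canSave : ∀ {k} → ∃ (Saves k) → CanSave k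
    saves⇒canSave (ps , lg , S , sz , sf) = record
      { strategy = pad ps
      ; legal    = legal
      ; saved    = S
      ; size     = sz
      ; safe     = λ u u∈ t b → sf u u∈ (within-n t b)
      }
      where
      legal : ∀ t → LegalStep (pad ps) t
      legal t with t <? n
      ... | yes t<n = lg t<n
      ... | no  t≮n rewrite pad-⊥ ps (≮⇒≥ t≮n) | ∣⊥∣≡0 n =
        z≤n , λ u u∈⊥ → contradiction u∈⊥ ∉⊥

    canSave⇒saves : ∀ {k} → CanSave k → ∃ (Saves k)
    canSave⇒saves c = ps , lg , saved , size ,
      λ u u∈ b → safe u u∈ n (local n (sym ∘ eq) b)
      where
      open CanSave c
      ps : Vec (Subset n) n
      ps = tabulate (strategy ∘ toℕ)
      eq : ∀ {i} → i < n → strategy i ≡ pad ps i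
      eq = pad-tabulate n strategy
      lg : ∀ {t} → t < n → LegalStep (pad ps) t
      lg {t} t<n = subst (λ p → ∣ p ∣ ≤ firefighters t) (eq t<n) (proj₁ (legal t)) ,
        λ u u∈ b → proj₂ (legal t) u (subst (u ∈_) (sym (eq t<n)) u∈)
          (local t (λ i<t → sym (eq (≤-trans i<t (<⇒≤ t<n)))) b)

  canSave? : Decidable CanSave
  canSave? k = map′ saves⇒canSave canSave⇒saves (anyVec? (saves? k))

private
  greatest : {Q : Pred ℕ 0ℓ} → Decidable Q → ℕ → ℕ
  greatest Q? zero = zero
  greatest Q? (suc k) with Q? (suc k)
  ... | yes _ = suc k
  ... | no  _ = greatest Q? k

  greatest-holds : {Q : Pred ℕ 0ℓ} (Q? : Decidable Q) → Q 0 →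
                   ∀ k → Q (greatest Q? k)
  greatest-holds Q? q₀ zero = q₀
  greatest-holds Q? q₀ (suc k) with Q? (suc k)
  ... | yes q = q
  ... | no  _ = greatest-holds Q? q₀ k

  greatest-upper : {Q : Pred ℕ 0ℓ} (Q? : Decidable Q) →
                   ∀ k {j} → j ≤ k → Q j → j ≤ greatest Q? k
  greatest-upper Q? zero    j≤k q = j≤k
  greatest-upper Q? (suc k) j≤k q with Q? (suc k)
  ... | yes _ = j≤k
  ... | no ¬q with m≤n⇒m<n∨m≡n j≤k
  ...   | inj₁ (s≤s j≤k′) = greatest-upper Q? k j≤k′ q
  ...   | inj₂ refl       = contradiction q ¬q

s : ∀ {n} → Graph n → Fin n → ℕ
s {n} G v = greatest (canSave? G v) n

s-attained : ∀ {n} (G : Graph n) v → CanSave G v (s G v)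
s-attained {n} G v = greatest-holds (canSave? G v) none n
  where
  none : CanSave G v 0
  none = record
    { strategy = λ _ → ⊥
    ; legal    = λ _ → subst (_≤ _) (sym (∣⊥∣≡0 n)) z≤n ,
                       λ _ u∈⊥ → contradiction u∈⊥ ∉⊥
    ; saved    = ⊥
    ; size     = ∣⊥∣≡0 n
    ; safe     = λ _ u∈⊥ → contradiction u∈⊥ ∉⊥
    }

s-maximal : ∀ {n} (G : Graph n) v {k} → CanSave G v k → k ≤ s G v
s-maximal {n} G v c = greatest-upper (canSave? G v) n
  (subst (_≤ n) (CanSave.size c) (∣p∣≤n (CanSave.saved c))) c

survivingRate : ∀ {n} .{{_ : NonZero n}} → Graph n → ℚ
survivingRate {n} G = (ℤ.+ ∑ (s G)) ℚ./ (n ^ 2)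
  where
  ∑ = sum +-0-commutativeMonoid
  instance _ = m^n≢0 n 2

-- Call v good if all but at most six vertices can be saved from a fire at v.
-- Some n/406 of the vertices are good, which suffices for n ≥ 8; for n < 8 it
-- suffices to save one vertex for each start.
--
-- Vertices of degree at most 4 are good.  Give v the charge deg v - 6, plus 1/2
-- for each corner at v that is not in a triangle; by Euler's formula the total
-- is at most 0.  A bad vertex of degree 5 takes 1/4 from each neighbour of
-- degree at least 7.  The other end of an edge between two triangles is such a
-- neighbour, since otherwise the fire is confined to two vertices; and for the
-- same reason two consecutive neighbours in a triangle are not both bad of
-- degree 5, which bounds what a vertex of degree at least 7 loses.
--
-- Call v hexagonal if it has degree 6 and only triangles around it.  If a dart e
-- and five vertices at fixed positions relative to e look like a piece of the
-- triangular lattice, the fire at the tail of e is confined to these six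
-- vertices.  So every dart at a bad hexagonal vertex has some other kind of
-- vertex at one of the five positions.  The positions are given by permutations
-- of the darts, so that a vertex x is met in this way at most 5 deg x times, and
-- a small payment for each of them leaves every bad vertex with positive charge.

module Submission where

open import Defs
open import Data.Nat.Base using (ℕ; NonTrivial; nonTrivial⇒nonZero)

import Algebra.Properties.CommutativeMonoid.Sum as FunctionalSum
open import Data.Bool.Base using (true; false)
open import Data.Fin.Base using (Fin; zero; suc; toℕ)
import Data.Fin.Properties as Fin
open import Data.Fin.Subset using (Subset; ⁅_⁆; _∪_; ∁; ∣_∣; ⊥) renaming (_∈_ to _∈ₛ_)
open import Data.Fin.Subset.Properties
  using (x∈⁅x⁆; x∈⁅y⁆⇒x≡y; ∣⁅x⁆∣≡1; x∈p∪q⁺; x∈p∪q⁻; ∣⊥∣≡0; ∉⊥; x∈∁p⇒x∉p; ∣∁p∣≡n∸∣p∣)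
import Data.Integer.Base as ℤ
import Data.Integer.Properties as ℤ
open import Data.List.Base
  using (List; []; _∷_; _++_; [_]; map; concatMap; filter; length; lookup; tabulate; allFin)
open import Data.List.Membership.Propositional using (_∈_)
open import Data.List.Membership.Propositional.Properties
  using ( ∈-∃++; ∈-++⁺ˡ; ∈-++⁺ʳ; ∈-++⁻; ∈-map⁺; ∈-concatMap⁺; ∈-concatMap⁻; ∈-allFin
        ; ∈-filter⁺; ∈-filter⁻)
import Data.List.Membership.DecPropositional as DecMembership
open import Data.List.Properties using (map-++; map-tabulate; length-map; length-filter; length-tabulate)
open import Data.List.Relation.Binary.Permutation.Propositional.Properties using (shift)
  renaming (map⁺ to ↭-map⁺)
open import Data.List.Relation.Unary.All as All using (All; []; _∷_)
open import Data.List.Relation.Unary.AllPairs as AllPairs using ([]; _∷_)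
import Data.List.Relation.Unary.AllPairs.Properties as AllPairs
open import Data.List.Relation.Unary.Any as Any using (here; there)
open import Data.List.Relation.Unary.Unique.Propositional using (Unique)
import Data.List.Relation.Unary.Unique.Propositional.Properties as Unique
open import Data.Nat.Base as Nat
  using (zero; suc; s≤s; z≤n; s≤s⁻¹; _+_; _*_; _∸_; _^_; _<_; pred)
open import Data.Nat.DivMod using (_%_; m≡m%n+[m/n]*n; m%n<n)
open import Data.Nat.GeneralisedArithmetic using (iterate)
open import Data.Nat.ListAction using () renaming (sum to listSum)
open import Data.Nat.ListAction.Properties using (sum-↭; sum-++)
open import Data.Nat.Properties
open import Data.Nat.Solver using (module +-*-Solver)
open import Data.Product.Base using (∃-syntax; _×_; _,_; proj₁; proj₂)
open import Data.Rational.Properties using (toℚᵘ-cancel-≤; toℚᵘ-fromℚᵘ)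
import Data.Rational.Unnormalised.Base as ℚᵘ
import Data.Rational.Unnormalised.Properties as ℚᵘ
open import Data.Sum.Base using (_⊎_; inj₁; inj₂)
open import Data.Vec.Base using ([]; _∷_)
open import Function.Base using (_∘_; id)
open import Function.Bundles using (Inverse; Equivalence)
open import Level using (0ℓ)
open import Relation.Binary.Core using (Rel)
open import Relation.Binary.PropositionalEquality
  using (_≡_; _≢_; refl; sym; trans; cong; cong₂; subst; subst₂; module ≡-Reasoning)
open import Relation.Nullary using (¬_; Dec; yes; no; contradiction)
open import Relation.Nullary.Decidable using (map′; _×-dec_; ¬?; recompute; True; toWitness)

open FunctionalSum +-0-commutativeMonoid using (sum)

-- A scope for the order of ℕ; in the theorem _≤_ is the order of ℚ.
module _ where
  open Nat using (_≤_; _/_)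

  -- Sums over lists and indicators of decidable propositions

  private variable
    I J : Set

  ∑ : List I → (I → ℕ) → ℕ
  ∑ xs h = listSum (map h xs)

  ∑-++ : ∀ (xs ys : List I) h → ∑ (xs ++ ys) h ≡ ∑ xs h + ∑ ys h
  ∑-++ xs ys h = trans (cong listSum (map-++ h xs ys)) (sum-++ (map h xs) (map h ys))

  ∑-concatMap : ∀ (k : I → List J) xs h → ∑ (concatMap k xs) h ≡ ∑ xs (λ x → ∑ (k x) h)
  ∑-concatMap k []       h = refl
  ∑-concatMap k (x ∷ xs) h =
    trans (∑-++ (k x) (concatMap k xs) h) (cong (∑ (k x) h +_) (∑-concatMap k xs h))

  ∑-mono : ∀ (xs : List I) {g h} → (∀ {x} → x ∈ xs → g x ≤ h x) → ∑ xs g ≤ ∑ xs h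
  ∑-mono []       g≤h = z≤n
  ∑-mono (x ∷ xs) g≤h = +-mono-≤ (g≤h (here refl)) (∑-mono xs (g≤h ∘ there))

  ∑-cong : ∀ (xs : List I) {g h} → (∀ {x} → x ∈ xs → g x ≡ h x) → ∑ xs g ≡ ∑ xs h
  ∑-cong []       g≡h = refl
  ∑-cong (x ∷ xs) g≡h = cong₂ _+_ (g≡h (here refl)) (∑-cong xs (g≡h ∘ there))

  ∑-+ : ∀ (xs : List I) g h → ∑ xs (λ x → g x + h x) ≡ ∑ xs g + ∑ xs h
  ∑-+ []       g h = refl
  ∑-+ (x ∷ xs) g h rewrite ∑-+ xs g h =
    solve 4 (λ a b c d → a :+ b :+ (c :+ d) := a :+ c :+ (b :+ d)) refl
      (g x) (h x) (∑ xs g) (∑ xs h)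
    where open +-*-Solver

  ∑-* : ∀ c (xs : List I) h → ∑ xs (λ x → c * h x) ≡ c * ∑ xs h
  ∑-* c []       h = sym (*-zeroʳ c)
  ∑-* c (x ∷ xs) h = trans (cong (c * h x +_) (∑-* c xs h)) (sym (*-distribˡ-+ c (h x) _))

  ∑-const : ∀ c (xs : List I) → ∑ xs (λ _ → c) ≡ length xs * c
  ∑-const c []       = refl
  ∑-const c (x ∷ xs) = cong (c +_) (∑-const c xs)

  -- The image of the first entry is cut out of `ys`; injectivity keeps the images of the other
  -- entries in what is left. Applied to injective maps of darts, this reindexes sums.
  ∑-inject : ∀ {xs : List I} {ys : List J} (σ : I → J) (h : J → ℕ) → Unique xs →
             (∀ {x y} → x ∈ xs → y ∈ xs → σ x ≡ σ y → x ≡ y) → (∀ {x} → x ∈ xs → σ x ∈ ys) →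
             ∑ xs (h ∘ σ) ≤ ∑ ys h
  ∑-inject σ h [] inj mem = z≤n
  ∑-inject {xs = x ∷ xs} σ h (x∉xs ∷ xs!) inj mem
    with as , bs , refl ← ∈-∃++ (mem (here refl)) = begin
      h (σ x) + ∑ xs (h ∘ σ)   ≤⟨ +-monoʳ-≤ (h (σ x)) (∑-inject σ h xs! (λ p q → inj (there p) (there q)) mem′) ⟩
      ∑ (σ x ∷ as ++ bs) h     ≡⟨ sum-↭ (↭-map⁺ h (shift (σ x) as bs)) ⟨
      ∑ (as ++ σ x ∷ bs) h     ∎
    where
    open ≤-Reasoning
    mem′ : ∀ {y} → y ∈ xs → σ y ∈ as ++ bs
    mem′ y∈ with ∈-++⁻ as (mem (there y∈))
    ... | inj₁ p           = ∈-++⁺ˡ p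
    ... | inj₂ (there p)   = ∈-++⁺ʳ as p
    ... | inj₂ (here eq) = contradiction (inj (here refl) (there y∈) (sym eq)) (All.lookup x∉xs y∈)

  ∑-≤const : ∀ {c} (xs : List I) {h} → (∀ {x} → x ∈ xs → c ≤ h x) → length xs * c ≤ ∑ xs h
  ∑-≤const xs c≤ = ≤-trans (≤-reflexive (sym (∑-const _ xs))) (∑-mono xs c≤)

  length-inject : ∀ {xs : List I} {ys : List J} (σ : I → J) → Unique xs →
    (∀ {x y} → x ∈ xs → y ∈ xs → σ x ≡ σ y → x ≡ y) → (∀ {x} → x ∈ xs → σ x ∈ ys) →
    length xs ≤ length ys
  length-inject {xs = xs} {ys} σ xs! inj mem =
    subst₂ _≤_ (trans (∑-const 1 xs) (*-identityʳ _)) (trans (∑-const 1 ys) (*-identityʳ _))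
      (∑-inject σ (λ _ → 1) xs! inj mem)

  concatMap-unique : ∀ (k : I → List J) {xs} → Unique xs → (∀ x → Unique (k x)) →
    (∀ {x y z} → z ∈ k x → z ∈ k y → x ≡ y) → Unique (concatMap k xs)
  concatMap-unique k {xs} xs! k! sep = Unique.concat⁺ (all xs)
    (AllPairs.map⁺ (AllPairs.map (λ x≢y {_} (p , q) → x≢y (sep p q)) xs!))
    where
    all : ∀ ys → All Unique (map k ys)
    all []       = []
    all (y ∷ ys) = k! y ∷ all ys

  ⟦_⟧ : {P : Set} → Dec P → ℕ
  ⟦ yes _ ⟧ = 1
  ⟦ no  _ ⟧ = 0

  ⟦⟧-yes : {P : Set} (P? : Dec P) → P → ⟦ P? ⟧ ≡ 1
  ⟦⟧-yes (yes _) p = refl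
  ⟦⟧-yes (no ¬p) p = contradiction p ¬p

  ⟦⟧-no : {P : Set} (P? : Dec P) → ¬ P → ⟦ P? ⟧ ≡ 0
  ⟦⟧-no (yes p) ¬p = contradiction p ¬p
  ⟦⟧-no (no _)  ¬p = refl

  ⟦⟧≤1 : {P : Set} (P? : Dec P) → ⟦ P? ⟧ ≤ 1
  ⟦⟧≤1 (yes _) = ≤-refl
  ⟦⟧≤1 (no _)  = z≤n

  ⟦⟧-≤ : {P : Set} (P? : Dec P) → ∀ {k} → (P → 1 ≤ k) → ⟦ P? ⟧ ≤ k
  ⟦⟧-≤ (yes p) f = f p
  ⟦⟧-≤ (no _)  f = z≤n

  ∑-member : ∀ {xs : List I} {x} h → x ∈ xs → h x ≤ ∑ xs h
  ∑-member h (here refl) = m≤m+n _ _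
  ∑-member h (there x∈)  = ≤-trans (∑-member h x∈) (m≤n+m _ _)

  length-allFin : ∀ n → length (allFin n) ≡ n
  length-allFin n = length-tabulate id

  -- Arithmetic of the discharging

  numeric : ∀ {i j} {_ : True (i ≤? j)} → i ≤ j
  numeric {_} {_} {i≤j} = toWitness i≤j

  -- The discharging inequality at a vertex of degree d, with 8U as the unit of
  -- charge: S sums the shares of the faces at the vertex in their edges, N counts
  -- the corners that are not triangular, In and Out count the transfers received
  -- and given, c marks the vertices that pay 5d, and h and g mark the bad
  -- hexagonal and the good ones.  The bound on U is 6 + 5d for d = 7,
  -- where the inequality is tight.
  module Arithmetic {d In Out N S c h g : ℕ} {U : ℕ} (41≤U : 41 ≤ U) where
    open ≤-Reasoning
    open +-*-Solver

    LHS RHS : ℕ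
    LHS = (6 + 5 * (d * c)) + U * (48 + 2 * Out + 4 * S)
    RHS = U * (24 * d + 2 * In + 48 * g) + (d * h + 36 * g)

    -- `δ` is slack in the part multiplied by `U`; each unit of it is worth at least 41 outside that
    -- part.
    combine : ∀ {a b x y} δ → a + δ ≤ b → x ≤ 41 * δ + y → x + U * a ≤ U * b + y
    combine {a} {b} {x} {y} δ a+δ≤b x≤ = begin
      x + U * a            ≤⟨ +-monoˡ-≤ (U * a) (≤-trans x≤ (+-monoˡ-≤ y (*-monoˡ-≤ δ 41≤U))) ⟩
      U * δ + y + U * a    ≡⟨ solve 4 (λ u δ y a → u :* δ :+ y :+ u :* a := u :* (a :+ δ) :+ y) refl U δ y a ⟩
      U * (a + δ) + y      ≤⟨ +-monoˡ-≤ y (*-monoʳ-≤ U a+δ≤b) ⟩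
      U * b + y            ∎

    -- Even with shares of 6, as on digons, `4 * S` is at most `24 * d`. The term `48 * g` cancels
    -- the 48, and `36 = 6 + 5 * 6` covers the payment.
    light-good : g ≡ 1 → d ≤ 6 → Out ≡ 0 → c ≤ 1 → S ≤ d * 6 → LHS ≤ RHS
    light-good refl d≤6 refl c≤1 S≤ = combine 0 (begin
        48 + 4 * S + 0                ≡⟨ +-identityʳ _ ⟩
        48 + 4 * S                    ≤⟨ +-monoʳ-≤ 48 (*-monoʳ-≤ 4 S≤) ⟩
        48 + 4 * (d * 6)              ≤⟨ m≤m+n _ (2 * In) ⟩
        48 + 4 * (d * 6) + 2 * In
          ≡⟨ solve 2 (λ d i → con 48 :+ con 4 :* (d :* con 6) :+ con 2 :* i := con 24 :* d :+ con 2 :* i :+ con 48) refl d In ⟩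
        24 * d + 2 * In + 48          ∎)
      (≤-trans (+-monoʳ-≤ 6 (*-monoʳ-≤ 5 (*-mono-≤ d≤6 c≤1))) (m≤n+m 36 (d * h)))

    -- From `2 * Out ≤ d + N` and `S + N ≤ 4 * d` the slack is at least `7 * d - 48 = 1 + 7 * k`,
    -- where `d = k + 7`. Outside `U` at most `41 + 5 * k` has to be paid.
    heavy : 7 ≤ d → c ≤ 1 → S + N ≤ d * 4 → Out + Out ≤ d + N → LHS ≤ RHS
    heavy 7≤d c≤1 S+N≤ Out≤ = combine (1 + 7 * k) (begin
        48 + 2 * Out + 4 * S + (1 + 7 * k)
          ≡⟨ solve 3 (λ o s k → con 48 :+ con 2 :* o :+ con 4 :* s :+ (con 1 :+ con 7 :* k) :=
                                con 49 :+ con 7 :* k :+ (o :+ o) :+ con 4 :* s) refl Out S k ⟩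
        49 + 7 * k + (Out + Out) + 4 * S
          ≤⟨ +-monoˡ-≤ (4 * S) (+-monoʳ-≤ (49 + 7 * k) Out≤) ⟩
        49 + 7 * k + (d + N) + 4 * S   ≤⟨ m≤m+n _ (3 * N) ⟩
        49 + 7 * k + (d + N) + 4 * S + 3 * N
          ≡⟨ solve 4 (λ k d n s → con 49 :+ con 7 :* k :+ (d :+ n) :+ con 4 :* s :+ con 3 :* n :=
                                  con 7 :* (k :+ con 7) :+ d :+ con 4 :* (s :+ n)) refl k d N S ⟩
        7 * (k + 7) + d + 4 * (S + N)  ≡⟨ cong (λ m → 7 * m + d + 4 * (S + N)) k+7 ⟩
        7 * d + d + 4 * (S + N)        ≤⟨ +-monoʳ-≤ (7 * d + d) (*-monoʳ-≤ 4 S+N≤) ⟩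
        7 * d + d + 4 * (d * 4)
          ≡⟨ solve 1 (λ d → con 7 :* d :+ d :+ con 4 :* (d :* con 4) := con 24 :* d) refl d ⟩
        24 * d                         ≤⟨ ≤-trans (m≤m+n _ (2 * In)) (m≤m+n _ (48 * g)) ⟩
        24 * d + 2 * In + 48 * g       ∎)
      (begin
        6 + 5 * (d * c)                ≤⟨ +-monoʳ-≤ 6 (*-monoʳ-≤ 5 (*-monoʳ-≤ d c≤1)) ⟩
        6 + 5 * (d * 1)                ≡⟨ cong (λ m → 6 + 5 * (m * 1)) k+7 ⟨
        6 + 5 * ((k + 7) * 1)
          ≡⟨ solve 1 (λ k → con 6 :+ con 5 :* ((k :+ con 7) :* con 1) := con 41 :* con 1 :+ con 5 :* k) refl k ⟩
        41 * 1 + 5 * k                 ≤⟨ +-monoʳ-≤ 41 (*-mono-≤ (numeric {5} {41}) (m≤m+n k (6 * k))) ⟩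
        41 * 1 + 41 * (7 * k)          ≡⟨ *-distribˡ-+ 41 1 (7 * k) ⟨
        41 * (1 + 7 * k)               ≤⟨ m≤m+n _ (d * h + 36 * g) ⟩
        41 * (1 + 7 * k) + (d * h + 36 * g) ∎)
      where
      k : ℕ
      k = d ∸ 7
      k+7 : k + 7 ≡ d
      k+7 = m∸n+n≡m 7≤d

    -- A corner that is not triangular lowers `4 * S` by 4 and may cost two transfers, also worth 4.
    -- After these cancel, `120 + 2 * 5` exceeds `48 + 4 * 20` by the slack 2.
    five : d ≡ 5 → Out ≡ 0 → c ≡ 0 → S + N ≤ d * 4 → 5 ≤ In + (N + N) → LHS ≤ RHS
    five refl refl refl S+N≤ In≥ = combine 2 (+-cancelʳ-≤ (4 * N) _ _ (begin
        48 + 4 * S + 2 + 4 * N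
          ≡⟨ solve 2 (λ s n → con 48 :+ con 4 :* s :+ con 2 :+ con 4 :* n := con 50 :+ con 4 :* (s :+ n)) refl S N ⟩
        50 + 4 * (S + N)               ≤⟨ +-monoʳ-≤ 50 (*-monoʳ-≤ 4 S+N≤) ⟩
        120 + 2 * 5                    ≤⟨ +-monoʳ-≤ 120 (*-monoʳ-≤ 2 In≥) ⟩
        120 + 2 * (In + (N + N))       ≤⟨ m≤m+n _ (48 * g) ⟩
        120 + 2 * (In + (N + N)) + 48 * g
          ≡⟨ solve 3 (λ i n g → con 120 :+ con 2 :* (i :+ (n :+ n)) :+ g :=
                                con 120 :+ con 2 :* i :+ g :+ con 4 :* n) refl In N (48 * g) ⟩
        120 + 2 * In + 48 * g + 4 * N  ∎))
      (≤-trans (numeric {6} {82}) (m≤m+n 82 (5 * h + 36 * g)))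

    -- There is no slack here, so the constant 6 is paid by the six darts at the vertex, through
    -- `d * h = 6`.
    six-hex : d ≡ 6 → Out ≡ 0 → c ≡ 0 → h ≡ 1 → S + N ≤ d * 4 → LHS ≤ RHS
    six-hex refl refl refl refl S+N≤ = combine 0 (begin
        48 + 4 * S + 0                 ≡⟨ +-identityʳ _ ⟩
        48 + 4 * S                     ≤⟨ +-monoʳ-≤ 48 (*-monoʳ-≤ 4 (≤-trans (m≤m+n S N) S+N≤)) ⟩
        144                            ≤⟨ ≤-trans (m≤m+n 144 (2 * In)) (m≤m+n _ (48 * g)) ⟩
        144 + 2 * In + 48 * g          ∎)
      (m≤m+n 6 (36 * g))

    -- One corner that is not triangular gives slack 4, hence `164 = 41 * 4` against at most
    -- `36 = 6 + 5 * 6`.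
    six : d ≡ 6 → Out ≡ 0 → c ≤ 1 → 1 ≤ N → S + N ≤ d * 4 → LHS ≤ RHS
    six refl refl c≤1 1≤N S+N≤ = combine 4 (begin
        48 + 4 * S + 4                 ≤⟨ +-monoʳ-≤ (48 + 4 * S) (*-monoʳ-≤ 4 1≤N) ⟩
        48 + 4 * S + 4 * N
          ≡⟨ solve 2 (λ s n → con 48 :+ con 4 :* s :+ con 4 :* n := con 48 :+ con 4 :* (s :+ n)) refl S N ⟩
        48 + 4 * (S + N)               ≤⟨ +-monoʳ-≤ 48 (*-monoʳ-≤ 4 S+N≤) ⟩
        144                            ≤⟨ ≤-trans (m≤m+n 144 (2 * In)) (m≤m+n _ (48 * g)) ⟩
        144 + 2 * In + 48 * g          ∎)
      (≤-trans (+-monoʳ-≤ 6 (*-monoʳ-≤ 5 (*-monoʳ-≤ 6 c≤1)))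
        (≤-trans (numeric {36} {164}) (m≤m+n 164 (6 * h + 36 * g))))

  -- From the number of good vertices to the surviving rate

  sum≡∑ : ∀ {n} (f : Fin n → ℕ) → sum f ≡ ∑ (allFin n) f
  sum≡∑ f = trans (go f) (sym (cong listSum (map-tabulate id f)))
    where
    go : ∀ {n} (f : Fin n → ℕ) → sum f ≡ listSum (tabulate f)
    go {zero}  f = refl
    go {suc n} f = cong (f zero +_) (go (f ∘ suc))

  -- Since `48 * 50 + 36 = 6 * 406`, the hypothesis says `n ≤ 406 * g`; and
  -- `406 * n ≤ 2712 * (n ∸ 6)` holds from `n = 8` on.
  quadratic : ∀ {n g} → 8 ≤ n → 6 * n ≤ (48 * 50 + 36) * g → n * n ≤ 2712 * ((n ∸ 6) * g)
  quadratic {n} {g} 8≤n 6n≤ = begin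
    n * n                 ≤⟨ *-monoˡ-≤ n (*-cancelˡ-≤ {n} {406 * g} 6 (≤-trans 6n≤ (≤-reflexive (*-assoc 6 406 g)))) ⟩
    406 * g * n           ≡⟨ trans (cong (_* n) (*-comm 406 g)) (*-assoc g 406 n) ⟩
    g * (406 * n)         ≤⟨ *-monoʳ-≤ g most ⟩
    g * (2712 * (n ∸ 6))  ≡⟨ trans (*-comm g _) (*-assoc 2712 (n ∸ 6) g) ⟩
    2712 * ((n ∸ 6) * g)  ∎
    where
    open ≤-Reasoning
    most : 406 * n ≤ 2712 * (n ∸ 6)
    most = subst (λ m → 406 * m ≤ 2712 * (n ∸ 6)) (m∸n+n≡m (≤-trans (numeric {6} {8}) 8≤n)) (begin
      406 * (n ∸ 6 + 6)              ≡⟨ *-distribˡ-+ 406 (n ∸ 6) 6 ⟩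
      406 * (n ∸ 6) + 406 * 6        ≤⟨ +-monoʳ-≤ (406 * (n ∸ 6))
          (≤-trans (numeric {2436} {2306 * 2}) (*-monoʳ-≤ 2306 (∸-monoˡ-≤ 6 8≤n))) ⟩
      406 * (n ∸ 6) + 2306 * (n ∸ 6) ≡⟨ *-distribʳ-+ (n ∸ 6) 406 2306 ⟨
      2712 * (n ∸ 6)                 ∎)

  sum-if-small : ∀ {n} (f : Fin n → ℕ) → n ≤ 7 → (∀ v → 1 ≤ f v) → n * n ≤ 2712 * ∑ (allFin n) f
  sum-if-small {n} f n≤7 1≤f = begin
    n * n                     ≤⟨ *-mono-≤ (≤-trans n≤7 (numeric {7} {2712})) (subst (_≤ ∑ (allFin n) f)
                                     (trans (*-identityʳ _) (length-allFin n))
                                     (∑-≤const (allFin n) λ {v} _ → 1≤f v)) ⟩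
    2712 * ∑ (allFin n) f     ∎
    where open ≤-Reasoning

  sum-if-large : ∀ {n} (f g : Fin n → ℕ) → 8 ≤ n → 6 * n ≤ (48 * 50 + 36) * ∑ (allFin n) g →
                 (∀ v → (n ∸ 6) * g v ≤ f v) → n * n ≤ 2712 * ∑ (allFin n) f
  sum-if-large {n} f g 8≤n 6n≤ g≤f = begin
    n * n                                     ≤⟨ quadratic 8≤n 6n≤ ⟩
    2712 * ((n ∸ 6) * ∑ (allFin n) g)         ≡⟨ cong (2712 *_) (∑-* (n ∸ 6) (allFin n) g) ⟨
    2712 * ∑ (allFin n) (λ v → (n ∸ 6) * g v) ≤⟨ *-monoʳ-≤ 2712 (∑-mono (allFin n) λ {v} _ → g≤f v) ⟩
    2712 * ∑ (allFin n) f                     ∎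
    where open ≤-Reasoning

  rate-bound : ∀ m (f : Fin (suc m) → ℕ) → let n = suc m in n * n ≤ 2712 * ∑ (allFin n) f →
               1 * n ^ 2 ≤ sum f * 2712
  rate-bound m f n²≤ = begin
    1 * n ^ 2             ≡⟨ trans (*-identityˡ (n ^ 2)) (cong (n *_) (*-identityʳ n)) ⟩
    n * n                 ≤⟨ n²≤ ⟩
    2712 * ∑ (allFin n) f ≡⟨ cong (2712 *_) (sum≡∑ f) ⟨
    2712 * sum f          ≡⟨ *-comm 2712 (sum f) ⟩
    sum f * 2712          ∎
    where
    open ≤-Reasoning
    n : ℕ
    n = suc m

  -- Containing a fire

  ∣p∪q∣≤∣p∣+∣q∣ : ∀ {n} (p q : Subset n) → ∣ p ∪ q ∣ ≤ ∣ p ∣ + ∣ q ∣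
  ∣p∪q∣≤∣p∣+∣q∣ []          []          = z≤n
  ∣p∪q∣≤∣p∣+∣q∣ (true  ∷ p) (true  ∷ q) =
    s≤s (≤-trans (∣p∪q∣≤∣p∣+∣q∣ p q) (+-monoʳ-≤ ∣ p ∣ (n≤1+n _)))
  ∣p∪q∣≤∣p∣+∣q∣ (true  ∷ p) (false ∷ q) = s≤s (∣p∪q∣≤∣p∣+∣q∣ p q)
  ∣p∪q∣≤∣p∣+∣q∣ (false ∷ p) (true  ∷ q) =
    ≤-trans (s≤s (∣p∪q∣≤∣p∣+∣q∣ p q)) (≤-reflexive (sym (+-suc ∣ p ∣ ∣ q ∣)))
  ∣p∪q∣≤∣p∣+∣q∣ (false ∷ p) (false ∷ q) = ∣p∪q∣≤∣p∣+∣q∣ p q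

  fromList : ∀ {n} → List (Fin n) → Subset n
  fromList []       = ⊥
  fromList (x ∷ xs) = ⁅ x ⁆ ∪ fromList xs

  ∈-fromList⁺ : ∀ {n u} {xs : List (Fin n)} → u ∈ xs → u ∈ₛ fromList xs
  ∈-fromList⁺ (here refl) = x∈p∪q⁺ (inj₁ (x∈⁅x⁆ _))
  ∈-fromList⁺ (there u∈)  = x∈p∪q⁺ (inj₂ (∈-fromList⁺ u∈))

  ∈-fromList⁻ : ∀ {n u} (xs : List (Fin n)) → u ∈ₛ fromList xs → u ∈ xs
  ∈-fromList⁻ []       u∈ = contradiction u∈ ∉⊥
  ∈-fromList⁻ (x ∷ xs) u∈ with x∈p∪q⁻ ⁅ x ⁆ (fromList xs) u∈
  ... | inj₁ u∈x = here (x∈⁅y⁆⇒x≡y x u∈x)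
  ... | inj₂ u∈xs = there (∈-fromList⁻ xs u∈xs)

  ∣fromList∣ : ∀ {n} (xs : List (Fin n)) → ∣ fromList xs ∣ ≤ length xs
  ∣fromList∣ {n} []   = ≤-reflexive (∣⊥∣≡0 n)
  ∣fromList∣ (x ∷ xs) = ≤-trans (∣p∪q∣≤∣p∣+∣q∣ ⁅ x ⁆ (fromList xs))
    (+-mono-≤ (≤-reflexive (∣⁅x⁆∣≡1 x)) (∣fromList∣ xs))

  pattern 0th p = here p
  pattern 1st p = there (0th p)
  pattern 2nd p = there (1st p)
  pattern 3rd p = there (2nd p)
  pattern 4th p = there (3rd p)
  pattern 5th p = there (4th p)
  pattern 6th p = there (5th p)
  pattern 7th p = there (6th p)

  UpTo : ∀ {A : Set} → (ℕ → List A) → ℕ → A → Set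
  UpTo xs t u = ∃[ j ] j < suc t × u ∈ xs j

  module _ {n} (G : Graph n) (v : Fin n) where
    open Graph G

    -- The fire may reach new t at time t at the earliest.  A vertex of shield t
    -- that burns already is simply not protected.
    record Containment : Set where
      field
        new shield : ℕ → List (Fin n)
        burnt      : List (Fin n)
        start∈new  : v ∈ new 0
        few        : ∀ t → length (shield t) ≤ firefighters t
        new⊆burnt  : ∀ t {u} → u ∈ new t → u ∈ burnt
        closed     : ∀ t {w u} → w ∈ new t → Adj w u → UpTo new (suc t) u ⊎ UpTo shield t u

    -- By induction on time, whatever burns at time `t` is listed in `new` up to `t`. The strategy
    -- omits from `shield t` the vertices listed by then, which makes it legal.
    contain : (c : Containment) → n ≤ length (Containment.burnt c) + s G v
    contain c = ≤-trans (m≤n+m∸n n ∣ fromList burnt ∣) (+-mono-≤ (∣fromList∣ burnt)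
      (≤-trans (≤-reflexive (sym (∣∁p∣≡n∸∣p∣ (fromList burnt)))) (s-maximal G v canSave)))
      where
      open Containment c
      open DecMembership (Fin._≟_ {n}) using (_∈?_)

      reached? : ∀ t u → Dec (UpTo new t u)
      reached? t u = anyUpTo? (λ j → u ∈? new j) (suc t)

      P : Strategy n
      P t = fromList (filter (λ u → ¬? (reached? t u)) (shield t))

      weaken : ∀ {xs : ℕ → List (Fin n)} {i t u} → i ≤ t → UpTo xs i u → UpTo xs t u
      weaken i≤t (j , j<i , u∈) = j , ≤-trans j<i (s≤s i≤t) , u∈

      reached : ∀ {t u} → Burning G v P t u → UpTo new t u
      reached start = 0 , ≤-refl , start∈new
      reached (stay b) = weaken (n≤1+n _) (reached b)
      reached {suc t} (spread b a ¬p) with j , s≤s j≤t , w∈ ← reached b with closed j w∈ a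
      ... | inj₁ new∋ = weaken (s≤s j≤t) new∋
      ... | inj₂ (i , s≤s i≤j , u∈) with reached? i _
      -- The vertex was left unprotected because it was listed already, so it is accounted for.
      ...   | yes r = weaken (≤-trans i≤j (m≤n⇒m≤1+n j≤t)) r
      ...   | no ¬r = contradiction
        (i , s≤s (≤-trans i≤j j≤t) , ∈-fromList⁺ (∈-filter⁺ (λ u → ¬? (reached? i u)) u∈ ¬r)) ¬p

      canSave : CanSave G v ∣ ∁ (fromList burnt) ∣
      canSave = record
        { strategy = P
        ; legal    = λ t → ≤-trans (∣fromList∣ (filter _ (shield t)))
                             (≤-trans (length-filter _ (shield t)) (few t)) ,
                     λ u u∈ b → proj₂ (∈-filter⁻ (λ u → ¬? (reached? t u)) {xs = shield t} (∈-fromList⁻ _ u∈)) (reached b)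
        ; saved    = ∁ (fromList burnt)
        ; size     = refl
        ; safe     = λ u u∈ t b → let j , _ , u∈new = reached b in
                     x∈∁p⇒x∉p u∈ (∈-fromList⁺ (new⊆burnt j u∈new))
        }

    saves-one : ∀ {u} → u ≢ v → 1 ≤ s G v
    saves-one {u} u≢v = s-maximal G v record
      { strategy = P ; legal = legal ; saved = ⁅ u ⁆ ; size = ∣⁅x⁆∣≡1 u
      ; safe = λ w w∈ t b → safe t (subst (Burning G v P t) (x∈⁅y⁆⇒x≡y u w∈) b) }
      where
      P : Strategy n
      P zero    = ⁅ u ⁆
      P (suc _) = ⊥
      safe : ∀ t → ¬ Burning G v P t u
      safe zero    start           = u≢v refl
      safe (suc t) (stay b)        = safe t b
      safe (suc t) (spread _ _ ¬p) = ¬p (0 , s≤s z≤n , x∈⁅x⁆ u)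
      legal : ∀ t → LegalStep G v P t
      legal zero    = ≤-trans (≤-reflexive (∣⁅x⁆∣≡1 u)) (s≤s z≤n) ,
                      λ w w∈ b → safe 0 (subst (Burning G v P 0) (x∈⁅y⁆⇒x≡y u w∈) b)
      legal (suc t) = subst (_≤ 3) (sym (∣⊥∣≡0 n)) z≤n , λ w w∈ _ → ∉⊥ w∈

  -- Orbits

  lookup-index-injective : ∀ {A : Set} {x y : A} {xs} (p : x ∈ xs) (q : y ∈ xs) →
    Any.index p ≡ Any.index q → x ≡ y
  lookup-index-injective {xs = xs} p q eq =
    trans (lookup-index p) (trans (cong (lookup xs) eq) (sym (lookup-index q)))
    where
    lookup-index : ∀ {A : Set} {x : A} {xs} (p : x ∈ xs) → x ≡ lookup xs (Any.index p)
    lookup-index (here eq) = eq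
    lookup-index (there p) = lookup-index p

  module _ {A : Set} (f : A → A) where

    iterate-+ : ∀ x m k → iterate f x (m + k) ≡ iterate f (iterate f x m) k
    iterate-+ x zero    k = refl
    iterate-+ x (suc m) k = iterate-+ (f x) m k

    iterate-* : ∀ {x p} → iterate f x p ≡ x → ∀ q → iterate f x (q * p) ≡ x
    iterate-* eq zero = refl
    iterate-* {x} {p} eq (suc q) =
      trans (iterate-+ x p (q * p)) (trans (cong (λ y → iterate f y (q * p)) eq) (iterate-* eq q))

    iterate-comm : ∀ x k → iterate f (f x) k ≡ f (iterate f x k)
    iterate-comm x zero    = refl
    iterate-comm x (suc k) = iterate-comm (f x) k

    iterate-injective : (∀ {x y} → f x ≡ f y → x ≡ y) → ∀ k {x y} →
                        iterate f x k ≡ iterate f y k → x ≡ y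
    iterate-injective inj zero    eq = eq
    iterate-injective inj (suc k) eq = inj (iterate-injective inj k eq)

    walk : A → ℕ → List A
    walk x zero    = []
    walk x (suc k) = x ∷ walk (f x) k

    length-walk : ∀ x k → length (walk x k) ≡ k
    length-walk x zero    = refl
    length-walk x (suc k) = cong suc (length-walk (f x) k)

    ∈-walk : ∀ x {i k} → i < k → iterate f x i ∈ walk x k
    ∈-walk x {zero}  {suc k} _         = here refl
    ∈-walk x {suc i} {suc k} (s≤s i<k) = there (∈-walk (f x) i<k)

    walk-mono : ∀ {x y m k} → m ≤ k → y ∈ walk x m → y ∈ walk x k
    walk-mono (s≤s m≤k) (here eq)  = here eq
    walk-mono (s≤s m≤k) (there y∈) = there (walk-mono m≤k y∈)

    walk-all : ∀ {P : A → Set} x k → (∀ {i} → i < k → P (iterate f x i)) → All P (walk x k)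
    walk-all x zero    p = []
    walk-all x (suc k) p = p (s≤s z≤n) ∷ walk-all (f x) k (p ∘ s≤s)

    -- By injectivity a coincidence of later entries pulls back to a return to `x`, so only such
    -- returns have to be excluded.
    walk-unique : (∀ {x y} → f x ≡ f y → x ≡ y) → ∀ x k →
                  (∀ {i} → suc i < k → iterate f (f x) i ≢ x) → Unique (walk x k)
    walk-unique inj x zero    aperiodic = []
    walk-unique inj x (suc k) aperiodic = walk-all (f x) k (λ i<k → aperiodic (s≤s i<k) ∘ sym) ∷
      walk-unique inj (f x) k λ {i} i<k eq →
        aperiodic (m≤n⇒m≤1+n i<k) (inj (trans (sym (iterate-comm (f x) i)) eq))

  module Representatives {A : Set} {_≈_ : Rel A 0ℓ} {k} (count : ClassCount _≈_ k) where
    open ClassCount count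

    rep : Fin k → A
    rep c = proj₁ (surjective c)

    class-rep : ∀ c → class (rep c) ≡ c
    class-rep c = proj₂ (surjective c) refl

    class-≈ : ∀ {c x} → rep c ≈ x → class x ≡ c
    class-≈ {c} eq = trans (sym (Equivalence.from class-≡ eq)) (class-rep c)

    rep-≈ : ∀ x → rep (class x) ≈ x
    rep-≈ x = Equivalence.to class-≡ (class-rep (class x))

  -- Darts and rotations

  module Darts {n} (G : Graph n) where
    open Graph G
    open Dart public

    adjacency : (d : Dart G) → Adj (tail d) (head d)
    adjacency (dart u v uv) = recompute (adj? u v) uv

    tail≢head : ∀ (d : Dart G) → tail d ≢ head d
    tail≢head d eq = irrefl eq (adjacency d)

    dart-≡ : ∀ {d e : Dart G} → tail d ≡ tail e → head d ≡ head e → d ≡ e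
    dart-≡ refl refl = refl

    _≟ᵈ_ : (d e : Dart G) → Dec (d ≡ e)
    d ≟ᵈ e = map′ (λ (p , q) → dart-≡ p q) (λ { refl → refl , refl })
      (tail d Fin.≟ tail e ×-dec head d Fin.≟ head e)

    between : Fin n → Fin n → List (Dart G)
    between u v with adj? u v
    ... | yes uv = [ dart u v uv ]
    ... | no  _  = []

    ∈-between⁺ : ∀ d → d ∈ between (tail d) (head d)
    ∈-between⁺ d with adj? (tail d) (head d)
    ... | yes _   = here refl
    ... | no ¬adj = contradiction (adjacency d) ¬adj

    ∈-between⁻ : ∀ {u v d} → d ∈ between u v → tail d ≡ u × head d ≡ v
    ∈-between⁻ {u} {v} d∈ with adj? u v
    ∈-between⁻ (here refl) | yes _ = refl , refl

    between-unique : ∀ u v → Unique (between u v)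
    between-unique u v with adj? u v
    ... | yes _ = [] ∷ []
    ... | no _  = []

    at : Fin n → List (Dart G)
    at u = concatMap (between u) (allFin n)

    deg : Fin n → ℕ
    deg u = length (at u)

    darts : List (Dart G)
    darts = concatMap at (allFin n)

    ∈-concatMap-allFin : ∀ {A : Set} {m} (k : Fin m → List A) i {x} → x ∈ k i → x ∈ concatMap k (allFin m)
    ∈-concatMap-allFin k i x∈ = ∈-concatMap⁺ k (Any.map (λ { refl → x∈ }) (∈-allFin i))

    ∈-at : ∀ d → d ∈ at (tail d)
    ∈-at d = ∈-concatMap-allFin (between (tail d)) (head d) (∈-between⁺ d)

    ∈-at⁺ : ∀ {d u} → tail d ≡ u → d ∈ at u
    ∈-at⁺ refl = ∈-at _

    ∈-at⁻ : ∀ {u d} → d ∈ at u → tail d ≡ u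
    ∈-at⁻ {u} d∈ with _ , p ← Any.satisfied (∈-concatMap⁻ (between u) {xs = allFin n} d∈) = proj₁ (∈-between⁻ p)

    ∈-darts : ∀ d → d ∈ darts
    ∈-darts d = ∈-concatMap-allFin at (tail d) (∈-at d)

    at-unique : ∀ u → Unique (at u)
    at-unique u = concatMap-unique (between u) (Unique.allFin⁺ n) (between-unique u)
      λ p q → trans (sym (proj₂ (∈-between⁻ p))) (proj₂ (∈-between⁻ q))

    darts-unique : Unique darts
    darts-unique = concatMap-unique at (Unique.allFin⁺ n) at-unique
      λ p q → trans (sym (∈-at⁻ p)) (∈-at⁻ q)

    ∑-permute-≤ : ∀ (σ : Dart G → Dart G) h → (∀ {d e} → σ d ≡ σ e → d ≡ e) →
                  ∑ darts (h ∘ σ) ≤ ∑ darts h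
    ∑-permute-≤ σ h inj = ∑-inject σ h darts-unique (λ _ _ → inj) (λ _ → ∈-darts _)

  module Embedding {n} {G : Graph n} (R : RotationSystem G) where
    open Graph G
    open RotationSystem R
    open Darts G

    rev : Dart G → Dart G
    rev = reverse G

    rev-injective : ∀ {d e} → rev d ≡ rev e → d ≡ e
    rev-injective eq = cong rev eq

    next-injective : ∀ {d e} → next d ≡ next e → d ≡ e
    next-injective {d} {e} eq = trans (sym (Inverse.strictlyInverseʳ rotation d))
      (trans (cong (Inverse.from rotation) eq) (Inverse.strictlyInverseʳ rotation e))

    prev : Dart G → Dart G
    prev = Inverse.from rotation

    next-prev : ∀ d → next (prev d) ≡ d
    next-prev = Inverse.strictlyInverseˡ rotation

    tail-next : ∀ d → tail (next d) ≡ tail d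
    tail-next d = sym (Equivalence.to (cyclic {d}) (1 , refl))

    tail-prev : ∀ d → tail (prev d) ≡ tail d
    tail-prev d = trans (sym (tail-next (prev d))) (cong tail (next-prev d))

    tail-iterate : ∀ d k → tail (iterate next d k) ≡ tail d
    tail-iterate d k = sym (Equivalence.to (cyclic {d}) (k , refl))

    ∑-next-≤ : ∀ h u → ∑ (at u) (h ∘ next) ≤ ∑ (at u) h
    ∑-next-≤ h u = ∑-inject next h (at-unique u) (λ _ _ → next-injective)
      λ d∈ → ∈-at⁺ (trans (tail-next _) (∈-at⁻ d∈))

    ∑-next-≥ : ∀ h u → ∑ (at u) h ≤ ∑ (at u) (h ∘ next)
    ∑-next-≥ h u = ≤-trans (≤-reflexive (∑-cong (at u) λ _ → cong h (sym (next-prev _))))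
      (∑-inject prev (h ∘ next) (at-unique u)
        (λ _ _ eq → trans (sym (next-prev _)) (trans (cong next eq) (next-prev _)))
        λ d∈ → ∈-at⁺ (trans (tail-prev _) (∈-at⁻ d∈)))

    -- Among the first `deg (tail e) + 1` iterates, which all leave the same vertex, two coincide;
    -- injectivity of `next` removes the iterations common to both.
    recurrence : ∀ e → ∃[ p ] suc p ≤ deg (tail e) × iterate next e (suc p) ≡ e
    recurrence e with Fin.pigeonhole (n<1+n (deg (tail e)))
        (λ i → Any.index (∈-at⁺ {iterate next e (toℕ i)} (tail-iterate e (toℕ i))))
    ... | i , j , i<j , eq = p , ≤-trans p< (s≤s⁻¹ (Fin.toℕ<n j)) ,
          iterate-injective next next-injective (toℕ i) (begin
            iterate next (iterate next e (suc p)) (toℕ i) ≡⟨ iterate-+ next e (suc p) (toℕ i) ⟨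
            iterate next e (suc p + toℕ i)                ≡⟨ cong (iterate next e) p+i ⟩
            iterate next e (toℕ j)                        ≡⟨ lookup-index-injective
              (∈-at⁺ (tail-iterate e (toℕ i))) (∈-at⁺ (tail-iterate e (toℕ j))) eq ⟨
            iterate next e (toℕ i)                        ∎)
      where
      open ≡-Reasoning
      p : ℕ
      p = toℕ j ∸ suc (toℕ i)
      p+i : suc p + toℕ i ≡ toℕ j
      p+i = trans (sym (+-suc p (toℕ i))) (m∸n+n≡m i<j)
      p< : suc p ≤ toℕ j
      p< = ≤-trans (m≤m+n (suc p) (toℕ i)) (≤-reflexive p+i)

    walk-covers-period : ∀ e p → iterate next e (suc p) ≡ e →
                         ∀ {d} → tail d ≡ tail e → d ∈ walk next e (suc p)
    walk-covers-period e p ret {d} eq with k , refl ← Equivalence.from (cyclic {e} {d}) (sym eq) =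
      subst (_∈ walk next e (suc p)) (sym reduce) (∈-walk next e (m%n<n k (suc p)))
      where
      open ≡-Reasoning
      reduce : iterate next e k ≡ iterate next e (k % suc p)
      reduce = begin
        iterate next e k ≡⟨ cong (iterate next e) (trans (m≡m%n+[m/n]*n k (suc p)) (+-comm (k % suc p) _)) ⟩
        iterate next e ((k / suc p) * suc p + k % suc p) ≡⟨ iterate-+ next e ((k / suc p) * suc p) _ ⟩
        iterate next (iterate next e ((k / suc p) * suc p)) (k % suc p)
          ≡⟨ cong (λ y → iterate next y (k % suc p)) (iterate-* next ret (k / suc p)) ⟩
        iterate next e (k % suc p) ∎

    -- By cyclicity every dart at the vertex is an iterate of `e`, so one period lists them all and
    -- cannot be shorter than the degree.
    period≡deg : ∀ e p → suc p ≤ deg (tail e) → iterate next e (suc p) ≡ e → suc p ≡ deg (tail e)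
    period≡deg e p p≤ ret = ≤-antisym p≤ (subst (deg (tail e) ≤_) (length-walk next e (suc p))
      (length-inject id (at-unique (tail e)) (λ _ _ → id)
        λ d∈ → walk-covers-period e p ret (∈-at⁻ d∈)))

    returns : ∀ e → iterate next e (deg (tail e)) ≡ e
    returns e with p , p≤ , ret ← recurrence e =
      subst (λ k → iterate next e k ≡ e) (period≡deg e p p≤ ret) ret

    walk-covers : ∀ e {k} → deg (tail e) ≤ k → ∀ {d} → tail d ≡ tail e → d ∈ walk next e k
    walk-covers e deg≤k eq with p , p≤ , ret ← recurrence e =
      walk-mono next (≤-trans p≤ deg≤k) (walk-covers-period e p ret eq)

    neighbours : ∀ e {k} → deg (tail e) ≤ k → ∀ {u} → Adj (tail e) u → u ∈ map head (walk next e k)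
    neighbours e deg≤k eu = ∈-map⁺ head (walk-covers e deg≤k {dart _ _ eu} refl)

    -- Reducible configurations

    Good : Fin n → Set
    Good v = n ≤ 6 + s G v

    by : ∀ {A : Set} {xs : ℕ → List A} {t u} j {_ : True (j <? suc t)} → u ∈ xs j → UpTo xs t u
    by j {j<} u∈ = j , toWitness j< , u∈

    deg≤4⇒good : ∀ v → deg v ≤ 4 → Good v
    deg≤4⇒good v deg≤4 = ≤-trans (contain G v record
      { new = λ { zero → [ v ] ; (suc _) → [] }
      ; shield = λ { zero → map head (at v) ; (suc _) → [] }
      ; burnt = [ v ]
      ; start∈new = here refl
      ; few = λ { zero → ≤-trans (≤-reflexive (length-map head (at v))) deg≤4 ; (suc _) → z≤n }
      ; new⊆burnt = λ { zero → id ; (suc _) () }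
      ; closed = λ { zero (here refl) vu → inj₂ (by 0 (∈-map⁺ head (∈-at (dart _ _ vu)))) ; (suc _) () }
      }) (+-monoˡ-≤ (s G v) (s≤s z≤n))

    -- Protecting `xs` at the first step leaves only `w` for the fire to reach; protecting `ys` at
    -- the second step then encloses it.
    two-burn⇒good : ∀ {v w} xs ys → length xs ≤ 4 → length ys ≤ 3 →
      (∀ {u} → Adj v u → u ∈ w ∷ xs) → (∀ {u} → Adj w u → u ∈ v ∷ xs ++ ys) → Good v
    two-burn⇒good {v} {w} xs ys ∣xs∣ ∣ys∣ Nv Nw = ≤-trans (contain G v record
      { new = new
      ; shield = shield
      ; burnt = v ∷ w ∷ []
      ; start∈new = here refl
      ; few = λ { 0 → ∣xs∣ ; 1 → ∣ys∣ ; (suc (suc _)) → z≤n }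
      ; new⊆burnt = λ { 0 (here eq) → here eq ; 1 → there ; (suc (suc _)) () }
      ; closed = closed
      }) (+-monoˡ-≤ (s G v) (s≤s (s≤s z≤n)))
      where
      new shield : ℕ → List (Fin n)
      new 0 = [ v ]
      new 1 = [ w ]
      new _ = []
      shield 0 = xs
      shield 1 = ys
      shield _ = []
      closed : ∀ t {x u} → x ∈ new t → Adj x u → UpTo new (suc t) u ⊎ UpTo shield t u
      closed 0 (here refl) vu with Nv vu
      ... | here eq   = inj₁ (by 1 (here eq))
      ... | there u∈ = inj₂ (by 0 u∈)
      closed 1 (here refl) wu with Nw wu
      ... | here eq   = inj₁ (by 0 (here eq))
      ... | there u∈ with ∈-++⁻ xs u∈
      ...   | inj₁ p = inj₂ (by 0 p)
      ...   | inj₂ p = inj₂ (by 1 p)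
      closed (suc (suc _)) ()

    -- The length of the face divides 3, and length 1 is impossible without loops.
    Tri : Dart G → Set
    Tri d = faceStep (faceStep (faceStep d)) ≡ d

    faceStep-injective : ∀ {d e} → faceStep d ≡ faceStep e → d ≡ e
    faceStep-injective = rev-injective ∘ next-injective

    Tri-step⁻ : ∀ {d} → Tri (faceStep d) → Tri d
    Tri-step⁻ = faceStep-injective

    -- The face through the corner between e and next e contains rev e, and
    -- then next e; if it is a triangle then side e is its third edge, directed
    -- from head (next e) to head e.
    side : Dart G → Dart G
    side e = next (rev (next e))

    -- `reverse` is an involution definitionally, so `Tri (rev e)` unfolds to this very equation.
    next-rev-side : ∀ {e} → Tri (rev e) → next (rev (side e)) ≡ rev e
    next-rev-side = id

    head-side : ∀ {e} → Tri (rev e) → head (side e) ≡ head e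
    head-side {e} tri = trans (sym (tail-next (rev (side e)))) (cong tail tri)

    tail-side : ∀ e → tail (side e) ≡ head (next e)
    tail-side e = tail-next (rev (next e))

    Tri-next : ∀ {e} → Tri (rev e) → Tri (next e)
    Tri-next = cong faceStep

    Hex : Fin n → Set
    Hex v = deg v ≡ 6 × All (Tri ∘ rev) (at v)

    hex-returns : ∀ {e} → Hex (tail e) → iterate next e 6 ≡ e
    hex-returns {e} (deg6 , _) = subst (λ k → iterate next e k ≡ e) deg6 (returns e)

    hex-tri : ∀ {e} → Hex (tail e) → Tri (rev e)
    hex-tri {e} (_ , tris) = All.lookup tris (∈-at e)

    hex-neighbours : ∀ {e u} → Hex (tail e) → Adj (tail e) u → u ∈ map head (walk next e 6)
    hex-neighbours {e} (deg6 , _) = neighbours e (≤-reflexive deg6)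

    -- The triangle makes `rev (side e)` the dart just before `rev e` in the rotation at `head e`.
    fifth : ∀ {e} → Tri (rev e) → iterate next (rev e) 6 ≡ rev e →
            head (iterate next (rev e) 5) ≡ head (next e)
    fifth {e} tri ret =
      trans (cong head (next-injective (trans ret (sym (next-rev-side tri))))) (tail-side e)

    -- Six vertices burn: v, then two consecutive neighbours w₀ and w₁ of v,
    -- then z (their common neighbour other than v) and y′, then q.
    module HexPatch (e₀ : Dart G) where
      e₁ = next e₀
      e₅ = iterate next e₀ 5
      v  = tail e₀
      w₀ = head e₀
      w₁ = head e₁
      -- `A`, `B`, `Z`, `Y` and `Q` enumerate the darts at `w₀`, `w₁`, `z`, `y′` and `q`, beginning
      -- with the dart back to `v`, `v`, `w₁`, `w₁` and `z` respectively.
      A  = iterate next (rev e₀)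
      B  = iterate next (rev e₁)
      z  = head (B 2)
      y′ = head (B 3)
      Z  = iterate next (rev (B 2))
      Y  = iterate next (rev (B 3))
      q  = head (Z 4)
      Q  = iterate next (rev (Z 4))

      module _ (hv : Hex v) (hw₀ : Hex w₀) (hw₁ : Hex w₁) (hz : Hex z) (hy : Hex y′) (hq : Hex q) where

        at-v : ∀ k → Tri (rev (iterate next e₀ k))
        at-v k = hex-tri {iterate next e₀ k} (subst Hex (sym (tail-iterate e₀ k)) hv)
        at-w₀ : ∀ k → Tri (rev (A k))
        at-w₀ k = hex-tri {A k} (subst Hex (sym (tail-iterate (rev e₀) k)) hw₀)
        at-w₁ : ∀ k → Tri (rev (B k))
        at-w₁ k = hex-tri {B k} (subst Hex (sym (tail-iterate (rev e₁) k)) hw₁)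
        at-z : ∀ k → Tri (rev (Z k))
        at-z k = hex-tri {Z k} (subst Hex (sym (tail-iterate (rev (B 2)) k)) hz)

        A1 : head (A 1) ≡ head e₅
        A1 = trans (cong (head ∘ next ∘ rev) (sym (hex-returns hv))) (head-side (at-v 5))
        A5 : head (A 5) ≡ w₁
        A5 = fifth (at-v 0) (hex-returns hw₀)

        -- An equation of darts rather than of heads, so that `B2` can continue from it into the
        -- next triangle.
        A5′ : next (A 4) ≡ rev (side e₀)
        A5′ = next-injective (trans (hex-returns hw₀) (sym (next-rev-side (at-v 0))))

        B1 : head (B 1) ≡ w₀
        B1 = head-side (at-v 0)
        B2 : side (A 4) ≡ B 2
        B2 = cong (next ∘ rev) A5′
        z≡ : z ≡ head (A 4)
        z≡ = trans (cong head (sym B2)) (head-side (at-w₀ 4))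
        B5 : head (B 5) ≡ head (iterate next e₀ 2)
        B5 = fifth (at-v 1) (hex-returns hw₁)

        Z0 : head (Z 0) ≡ w₁
        Z0 = tail-iterate (rev e₁) 2
        Z1′ : Z 1 ≡ rev (A 4)
        Z1′ = trans (cong (next ∘ rev) (sym B2)) (next-rev-side (at-w₀ 4))
        Z1 : head (Z 1) ≡ w₀
        Z1 = trans (cong head Z1′) (tail-iterate (rev e₀) 4)
        Z2 : head (Z 2) ≡ head (A 3)
        Z2 = trans (cong (head ∘ next) Z1′) (head-side (at-w₀ 3))
        Z5 : head (Z 5) ≡ y′
        Z5 = fifth (at-w₁ 2) (hex-returns hz)
        Z5′ : next (Z 4) ≡ rev (side (B 2))
        Z5′ = next-injective (trans (hex-returns hz) (sym (next-rev-side (at-w₁ 2))))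

        Y0 : head (Y 0) ≡ w₁
        Y0 = tail-iterate (rev e₁) 3
        Y1 : head (Y 1) ≡ z
        Y1 = head-side (at-w₁ 2)
        Y2 : head (Y 2) ≡ q
        Y2 = trans (cong (head ∘ next ∘ rev) (sym Z5′)) (head-side (at-z 4))
        Y5 : head (Y 5) ≡ head (B 4)
        Y5 = fifth (at-w₁ 3) (hex-returns hy)

        Q0 : head (Q 0) ≡ z
        Q0 = tail-iterate (rev (B 2)) 4
        Q1 : head (Q 1) ≡ head (Z 3)
        Q1 = head-side (at-z 3)
        Q5 : head (Q 5) ≡ y′
        Q5 = trans (fifth (at-z 4) (hex-returns hq)) Z5

        new shield : ℕ → List (Fin n)
        new 0 = [ v ]
        new 1 = w₀ ∷ w₁ ∷ []
        new 2 = z ∷ y′ ∷ []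
        new 3 = [ q ]
        new _ = []
        -- Each list holds the outside neighbours newly met: four at `v`, three at `w₀` and `w₁`
        -- together, three at `z` and `y′` together, three at `q`.
        shield 0 = map head (walk next (iterate next e₀ 2) 4)
        shield 1 = head (A 2) ∷ head (A 3) ∷ head (B 4) ∷ []
        shield 2 = head (Z 3) ∷ head (Y 3) ∷ head (Y 4) ∷ []
        shield 3 = head (Q 2) ∷ head (Q 3) ∷ head (Q 4) ∷ []
        shield _ = []

        Caught : ℕ → Fin n → Set
        Caught t u = UpTo new (suc t) u ⊎ UpTo shield t u

        fire : ∀ {t u} j {_ : True (j <? suc (suc t))} → u ∈ new j → Caught t u
        fire j {j<} u∈ = inj₁ (by j {j<} u∈)

        wall : ∀ {t u} j {_ : True (j <? suc t)} → u ∈ shield j → Caught t u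
        wall j {j<} u∈ = inj₂ (by j {j<} u∈)

        closed : ∀ t {w u} → w ∈ new t → Adj w u → Caught t u
        closed 0 (0th refl) a = All.lookup {P = Caught 0}
          ( fire 1 (0th refl) ∷ fire 1 (1st refl) ∷ wall 0 (0th refl)
          ∷ wall 0 (1st refl) ∷ wall 0 (2nd refl) ∷ wall 0 (3rd refl) ∷ [])
          (hex-neighbours {e₀} hv a)
        closed 1 (0th refl) a = All.lookup {P = Caught 1}
          ( fire 0 (0th refl) ∷ wall 0 (3rd A1) ∷ wall 1 (0th refl)
          ∷ wall 1 (1st refl) ∷ fire 2 (0th (sym z≡)) ∷ fire 1 (1st A5) ∷ [])
          (hex-neighbours {A 0} hw₀ a)
        closed 1 (1st refl) a = All.lookup {P = Caught 1}
          ( fire 0 (0th (tail-next e₀)) ∷ fire 1 (0th B1) ∷ fire 2 (0th refl)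
          ∷ fire 2 (1st refl) ∷ wall 1 (2nd refl) ∷ wall 0 (0th B5) ∷ [])
          (hex-neighbours {B 0} hw₁ a)
        closed 2 (0th refl) a = All.lookup {P = Caught 2}
          ( fire 1 (1st Z0) ∷ fire 1 (0th Z1) ∷ wall 1 (1st Z2)
          ∷ wall 2 (0th refl) ∷ fire 3 (0th refl) ∷ fire 2 (1st Z5) ∷ [])
          (hex-neighbours {Z 0} hz a)
        closed 2 (1st refl) a = All.lookup {P = Caught 2}
          ( fire 1 (1st Y0) ∷ fire 2 (0th Y1) ∷ fire 3 (0th Y2)
          ∷ wall 2 (1st refl) ∷ wall 2 (2nd refl) ∷ wall 1 (2nd Y5) ∷ [])
          (hex-neighbours {Y 0} hy a)
        closed 3 (0th refl) a = All.lookup {P = Caught 3}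
          ( fire 2 (0th Q0) ∷ wall 2 (0th Q1) ∷ wall 3 (0th refl)
          ∷ wall 3 (1st refl) ∷ wall 3 (2nd refl) ∷ fire 2 (1st Q5) ∷ [])
          (hex-neighbours {Q 0} hq a)
        closed (suc (suc (suc (suc _)))) ()

        patch-good : Good v
        patch-good = contain G v record
          { new = new
          ; shield = shield
          ; burnt = v ∷ w₀ ∷ w₁ ∷ z ∷ y′ ∷ q ∷ []
          ; start∈new = here refl
          ; few = λ { 0 → ≤-refl ; 1 → ≤-refl ; 2 → ≤-refl ; 3 → ≤-refl
                    ; (suc (suc (suc (suc _)))) → z≤n }
          ; new⊆burnt = λ { 0 (0th eq) → 0th eq
                          ; 1 (0th eq) → 1st eq ; 1 (1st eq) → 2nd eq
                          ; 2 (0th eq) → 3rd eq ; 2 (1st eq) → 4th eq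
                          ; 3 (0th eq) → 5th eq
                          ; (suc (suc (suc (suc _)))) () }
          ; closed = closed
          }

    neighbours-⊆ : ∀ e {w k xs} → tail e ≡ w → deg w ≤ k →
                   All (_∈ xs) (map head (walk next e k)) → ∀ {u} → Adj w u → u ∈ xs
    neighbours-⊆ e refl deg≤k all a = All.lookup all (neighbours e deg≤k a)

    -- The ends of `d` share the third vertices of both triangles. After the four neighbours of
    -- `tail d` other than `head d` are protected, at most three unprotected neighbours of `head d`
    -- other than `tail d` remain.
    degree-five-edge : ∀ d → deg (tail d) ≡ 5 → Tri d → Tri (rev d) → deg (head d) ≤ 6 →
                       Good (tail d)
    degree-five-edge d deg5 tri tri′ deg≤6 = two-burn⇒good xs ys ≤-refl ≤-refl
      (neighbours d (≤-reflexive deg5))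
      -- Starting one dart before `rev d` puts `tail d` and the two shared neighbours first.
      (neighbours-⊆ (rev (side d)) (head-side tri′) deg≤6
        ( 1st (tail-side d)
        ∷ 0th (cong head (next-rev-side tri′))
        ∷ 4th (trans (cong (head ∘ next) (next-rev-side tri′)) second)
        ∷ 5th refl
        ∷ 6th refl
        ∷ 7th refl
        ∷ []))
      where
      xs ys : List (Fin n)
      xs = map head (walk next (next d) 4)
      ys = map head (walk next (iterate next (rev (side d)) 3) 3)
      c : Dart G
      c = iterate next d 4
      next-c : next c ≡ d
      next-c = subst (λ k → iterate next d k ≡ d) deg5 (returns d)
      second : head (next (rev d)) ≡ head c
      second = trans (cong (head ∘ next ∘ rev) (sym next-c))
        (head-side (Tri-step⁻ (subst Tri (sym next-c) tri)))

    -- `head e` and `head (next e)` are adjacent and share the neighbour `tail e`. The first step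
    -- protects all neighbours of `head e` but `head (next e)`, which leaves at most three for the
    -- second step.
    degree-five-pair : ∀ e → Tri (rev e) → deg (head e) ≡ 5 → deg (head (next e)) ≤ 5 →
                       Good (head e)
    degree-five-pair e tri deg5 deg≤5 = two-burn⇒good xs ys ≤-refl ≤-refl
      (neighbours-⊆ d (head-side tri) (≤-reflexive deg5)
        ( 0th (tail-side e)
        ∷ 1st refl
        ∷ 2nd refl
        ∷ 3rd refl
        ∷ 4th refl
        ∷ []))
      (neighbours-⊆ (rev (next e)) refl deg≤5
        ( 1st (trans (tail-next e) (cong head (sym (next-rev-side tri))))
        ∷ 0th (head-side tri)
        ∷ 5th refl
        ∷ 6th refl
        ∷ 7th refl
        ∷ []))
      where
      d : Dart G
      d = rev (side e)
      xs ys : List (Fin n)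
      xs = map head (walk next (next d) 4)
      ys = map head (walk next (iterate next (rev (next e)) 2) 3)

    -- Euler's formula

    Digon : Dart G → Set
    Digon d = faceStep (faceStep d) ≡ d

    -- 12 divided by the length of the face, so that the face collects 12; for
    -- faces of length at least 4, which collect more, divided by 4.
    share : Dart G → ℕ
    share d with faceStep (faceStep d) ≟ᵈ d | faceStep (faceStep (faceStep d)) ≟ᵈ d
    ... | yes _ | _     = 6
    ... | no  _ | yes _ = 4
    ... | no  _ | no  _ = 3

    share-digon : ∀ {d} → Digon d → 6 ≤ share d
    share-digon {d} digon with faceStep (faceStep d) ≟ᵈ d | faceStep (faceStep (faceStep d)) ≟ᵈ d
    ... | yes _ | _     = ≤-refl
    ... | no ¬p | yes _ = contradiction digon ¬p
    ... | no ¬p | no  _ = contradiction digon ¬p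

    share-tri : ∀ {d} → Tri d → 4 ≤ share d
    share-tri {d} tri with faceStep (faceStep d) ≟ᵈ d | faceStep (faceStep (faceStep d)) ≟ᵈ d
    ... | yes _ | _     = s≤s (s≤s (s≤s (s≤s z≤n)))
    ... | no _  | yes _ = ≤-refl
    ... | no _  | no ¬p = contradiction tri ¬p

    share-any : ∀ d → 3 ≤ share d
    share-any d with faceStep (faceStep d) ≟ᵈ d | faceStep (faceStep (faceStep d)) ≟ᵈ d
    ... | yes _ | _     = s≤s (s≤s (s≤s z≤n))
    ... | no _  | yes _ = s≤s (s≤s (s≤s z≤n))
    ... | no _  | no  _ = ≤-refl

    tail-faceStep : ∀ d → tail (faceStep d) ≡ head d
    tail-faceStep d = tail-next (rev d)

    faceStep≢ : ∀ d → faceStep d ≢ d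
    faceStep≢ d eq = tail≢head d (trans (sym (cong tail eq)) (tail-faceStep d))

    -- At most four darts of the face: they are distinct and already collect 12, so the exact length
    -- of a longer face does not enter.
    faceArc : Dart G → List (Dart G)
    faceArc d with faceStep (faceStep d) ≟ᵈ d | faceStep (faceStep (faceStep d)) ≟ᵈ d
    ... | yes _ | _     = walk faceStep d 2
    ... | no  _ | yes _ = walk faceStep d 3
    ... | no  _ | no  _ = walk faceStep d 4

    faceArc-unique : ∀ d → Unique (faceArc d)
    faceArc-unique d with faceStep (faceStep d) ≟ᵈ d | faceStep (faceStep (faceStep d)) ≟ᵈ d
    ... | yes _ | _     = walk-unique faceStep faceStep-injective d 2
      λ { {0} _ → faceStep≢ d ; {suc _} (s≤s (s≤s ())) }
    ... | no ¬p | yes _ = walk-unique faceStep faceStep-injective d 3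
      λ { {0} _ → faceStep≢ d ; {1} _ → ¬p ; {suc (suc _)} (s≤s (s≤s (s≤s ()))) }
    ... | no ¬p | no ¬q = walk-unique faceStep faceStep-injective d 4
      λ { {0} _ → faceStep≢ d ; {1} _ → ¬p ; {2} _ → ¬q ; {suc (suc (suc _))} (s≤s (s≤s (s≤s (s≤s ())))) }

    faceArc-orbit : ∀ d → All (SameOrbit faceStep d) (faceArc d)
    faceArc-orbit d with faceStep (faceStep d) ≟ᵈ d | faceStep (faceStep (faceStep d)) ≟ᵈ d
    ... | yes _ | _     = walk-all faceStep d 2 λ {i} _ → i , refl
    ... | no  _ | yes _ = walk-all faceStep d 3 λ {i} _ → i , refl
    ... | no  _ | no  _ = walk-all faceStep d 4 λ {i} _ → i , refl

    faceArc-share : ∀ d → 12 ≤ ∑ (faceArc d) share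
    faceArc-share d with faceStep (faceStep d) ≟ᵈ d | faceStep (faceStep (faceStep d)) ≟ᵈ d
    ... | yes p | _     = +-mono-≤ (share-digon p) (+-monoˡ-≤ 0 (share-digon (cong faceStep p)))
    ... | no  _ | yes q = +-mono-≤ (share-tri q) (+-mono-≤ (share-tri (cong faceStep q))
      (+-monoˡ-≤ 0 (share-tri (cong (faceStep ∘ faceStep) q))))
    ... | no  _ | no  _ = +-mono-≤ (share-any _) (+-mono-≤ (share-any _)
      (+-mono-≤ (share-any _) (+-monoˡ-≤ 0 (share-any _))))

    module _ (S : IsSpherical G R) where
      open IsSpherical S

      -- Only an inequality, since `V` does not count isolated vertices.
      vertices-≤ : V ≤ n
      vertices-≤ = subst₂ _≤_ (length-allFin V) (length-allFin n)
        (length-inject (tail ∘ rep) (Unique.allFin⁺ V)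
          (λ {c} {c′} _ _ eq → trans (sym (class-rep c)) (class-≈ (sym eq))) (λ _ → ∈-allFin _))
        where open Representatives vertices

      edges-≥ : length darts ≤ E * 2
      edges-≥ = begin
        length darts                     ≤⟨ length-inject id darts-unique (λ _ _ → id)
                                              (λ {d} _ → ∈-concatMap-allFin ends (class d) (end (rep-≈ d))) ⟩
        length (concatMap ends (allFin E)) ≡⟨ length≡ (concatMap ends (allFin E)) ⟩
        ∑ (concatMap ends (allFin E)) (λ _ → 1) ≡⟨ ∑-concatMap ends (allFin E) (λ _ → 1) ⟩
        ∑ (allFin E) (λ _ → 2)           ≡⟨ ∑-const 2 (allFin E) ⟩
        length (allFin E) * 2            ≡⟨ cong (_* 2) (length-allFin E) ⟩
        E * 2                            ∎
        where
        open Representatives edges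
        open ≤-Reasoning
        open ClassCount edges using (class)
        ends : Fin E → List (Dart G)
        ends c = rep c ∷ rev (rep c) ∷ []
        end : ∀ {d e} → SameOrbit rev d e → e ∈ d ∷ rev d ∷ []
        end (zero , refl) = 0th refl
        end (suc zero , refl) = 1st refl
        end (suc (suc k) , eq) = end (k , eq)
        length≡ : ∀ {A : Set} (xs : List A) → length xs ≡ ∑ xs (λ _ → 1)
        length≡ xs = sym (trans (∑-const 1 xs) (*-identityʳ _))

      -- Arcs chosen in different faces are disjoint, and each of them collects 12.
      faces-≤ : F * 12 ≤ ∑ darts share
      faces-≤ = begin
        F * 12                                      ≡⟨ cong (_* 12) (length-allFin F) ⟨
        length (allFin F) * 12                      ≤⟨ ∑-≤const (allFin F) (λ {c} _ → faceArc-share (rep c)) ⟩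
        ∑ (allFin F) (λ c → ∑ (faceArc (rep c)) share) ≡⟨ ∑-concatMap (faceArc ∘ rep) (allFin F) share ⟨
        ∑ (concatMap (faceArc ∘ rep) (allFin F)) share ≤⟨ ∑-inject id share
          (concatMap-unique (faceArc ∘ rep) (Unique.allFin⁺ F) (faceArc-unique ∘ rep)
            (λ {c} {c′} p q → trans (sym (class-≈ (All.lookup (faceArc-orbit (rep c)) p)))
                                    (class-≈ (All.lookup (faceArc-orbit (rep c′)) q))))
          (λ _ _ → id) (λ _ → ∈-darts _) ⟩
        ∑ darts share                               ∎
        where
        open Representatives faces
        open ≤-Reasoning

      -- Twelve times Euler's formula, weakened to `E ≤ V + F`, with edges counted by darts and
      -- faces by shares.
      euler-≤ : 6 * length darts ≤ 12 * n + ∑ darts share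
      euler-≤ = begin
        6 * length darts        ≤⟨ *-monoʳ-≤ 6 edges-≥ ⟩
        6 * (E * 2)             ≡⟨ trans (*-comm 6 (E * 2)) (*-assoc E 2 6) ⟩
        E * 12                  ≤⟨ *-monoˡ-≤ 12 (m≤m+n E (2 * C)) ⟩
        (E + 2 * C) * 12        ≡⟨ cong (_* 12) euler ⟨
        (V + F) * 12            ≡⟨ *-distribʳ-+ 12 V F ⟩
        V * 12 + F * 12         ≤⟨ +-mono-≤ (*-monoˡ-≤ 12 vertices-≤) faces-≤ ⟩
        n * 12 + ∑ darts share  ≡⟨ cong (_+ ∑ darts share) (*-comm n 12) ⟩
        12 * n + ∑ darts share  ∎
        where open ≤-Reasoning

    -- Discharging

    Bad₅ : Fin n → Set
    Bad₅ v = ¬ Good v × deg v ≡ 5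

    -- Opaque, since unfolding s is infeasible.
    abstract
      good? : ∀ v → Dec (Good v)
      good? v = n ≤? 6 + s G v

      tri? : ∀ d → Dec (Tri d)
      tri? d = faceStep (faceStep (faceStep d)) ≟ᵈ d

      hex? : ∀ v → Dec (Hex v)
      hex? v = deg v ≟ 6 ×-dec All.all? (λ e → tri? (rev e)) (at v)

      bad₅? : ∀ v → Dec (Bad₅ v)
      bad₅? v = ¬? (good? v) ×-dec deg v ≟ 5

    -- These are the marks `g`, `c` and `h` of `Arithmetic`.
    γ χ η : Fin n → ℕ
    γ v = ⟦ good? v ⟧
    χ v = ⟦ ¬? (hex? v) ×-dec ¬? (bad₅? v) ⟧
    η v = ⟦ hex? v ×-dec ¬? (good? v) ⟧

    τ : Dart G → ℕ
    τ d = ⟦ ¬? (tri? d) ⟧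

    -- The transfer along `d`, in quarters of a unit of charge: the tail receives it and the head
    -- gives it.
    pull : Dart G → ℕ
    pull d = ⟦ bad₅? (tail d) ×-dec 7 ≤? deg (head d) ⟧

    -- Every edge at a hexagonal vertex lies between two triangles, so `degree-five-edge` would make
    -- a neighbour of degree 5 good.
    hex⇒¬bad₅ : ∀ e {v} → tail e ≡ v → Hex v → ¬ Bad₅ (head e)
    hex⇒¬bad₅ e refl hv@(deg6 , _) (¬good , deg5) = ¬good
      (degree-five-edge (rev e) deg5 (hex-tri {e} hv)
        (subst Tri (next-prev e) (Tri-next {prev e} (hex-tri {prev e} (subst Hex (sym (tail-prev e)) hv))))
        (≤-reflexive deg6))

    χ-head : ∀ e {v} → tail e ≡ v → Hex v → ¬ Hex (head e) → 1 ≤ χ (head e)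
    χ-head e eq hv ¬h = ≤-reflexive (sym (⟦⟧-yes (¬? (hex? _) ×-dec ¬? (bad₅? _)) (¬h , hex⇒¬bad₅ e eq hv)))

    module _ (e : Dart G) where
      open HexPatch e

      -- Hexagonal positions are passed over until one is not: as the neighbour of
      -- a hexagonal vertex, it is not a bad vertex of degree 5 either.
      escape : Hex v → ¬ Good v → Dec (Hex w₀) → Dec (Hex w₁) → Dec (Hex z) → Dec (Hex y′) →
               Dec (Hex q) → 1 ≤ χ w₀ + (χ w₁ + (χ z + (χ y′ + χ q)))
      escape hv _ (no ¬h) _ _ _ _ = ≤-trans (χ-head e refl hv ¬h) (m≤m+n _ _)
      escape hv _ (yes _) (no ¬h) _ _ _ =
        ≤-trans (χ-head e₁ (tail-next e) hv ¬h) (≤-trans (m≤m+n _ _) (m≤n+m _ (χ w₀)))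
      escape hv _ (yes _) (yes hw₁) (no ¬h) _ _ =
        ≤-trans (χ-head (B 2) (tail-iterate (rev e₁) 2) hw₁ ¬h)
          (≤-trans (m≤m+n _ _) (≤-trans (m≤n+m _ (χ w₁)) (m≤n+m _ (χ w₀))))
      escape hv _ (yes _) (yes hw₁) (yes _) (no ¬h) _ =
        ≤-trans (χ-head (B 3) (tail-iterate (rev e₁) 3) hw₁ ¬h)
          (≤-trans (m≤m+n _ _) (≤-trans (m≤n+m _ (χ z)) (≤-trans (m≤n+m _ (χ w₁)) (m≤n+m _ (χ w₀)))))
      escape hv _ (yes _) (yes _) (yes hz) (yes _) (no ¬h) =
        ≤-trans (χ-head (Z 4) (tail-iterate (rev (B 2)) 4) hz ¬h)
          (≤-trans (m≤n+m _ (χ y′)) (≤-trans (m≤n+m _ (χ z))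
            (≤-trans (m≤n+m _ (χ w₁)) (m≤n+m _ (χ w₀)))))
      escape hv ¬good (yes hw₀) (yes hw₁) (yes hz) (yes hy) (yes hq) =
        contradiction (patch-good hv hw₀ hw₁ hz hy hq) ¬good

      η≤χ : η v ≤ χ w₀ + (χ w₁ + (χ z + (χ y′ + χ q)))
      η≤χ = ⟦⟧-≤ (hex? v ×-dec ¬? (good? v)) λ (hv , ¬good) →
        escape hv ¬good (hex? w₀) (hex? w₁) (hex? z) (hex? y′) (hex? q)

    -- Each of the five positions is the head of the image of `e` under an injective map of darts.
    -- Composed with `rev` it becomes a tail, so each position contributes at most the sum on the
    -- right.
    ∑η≤∑χ : ∑ darts (η ∘ tail) ≤ 5 * ∑ darts (χ ∘ tail)
    ∑η≤∑χ = begin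
      ∑ darts (η ∘ tail)       ≤⟨ ∑-mono darts (λ {e} _ → η≤χ e) ⟩
      ∑ darts (λ e → χ (head e) + (χ (head (next e)) + (χ (head (σ₂ e)) + (χ (head (σ₃ e)) + χ (head (σ₄ e))))))
        ≡⟨ trans (∑-+ darts _ _) (cong (∑ darts (χ ∘ head) +_)
             (trans (∑-+ darts _ _) (cong (∑ darts (χ ∘ head ∘ next) +_)
               (trans (∑-+ darts _ _) (cong (∑ darts (χ ∘ head ∘ σ₂) +_) (∑-+ darts _ _)))))) ⟩
      ∑ darts (χ ∘ head) + (∑ darts (χ ∘ head ∘ next) + (∑ darts (χ ∘ head ∘ σ₂)
        + (∑ darts (χ ∘ head ∘ σ₃) + ∑ darts (χ ∘ head ∘ σ₄))))
        ≤⟨ +-mono-≤ (reindex id id) (+-mono-≤ (reindex next next-injective) (+-mono-≤ (reindex σ₂ σ₂-inj)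
             (+-mono-≤ (reindex σ₃ (next-injective ∘ rev-injective ∘ iterate-injective next next-injective 3))
               (≤-trans (reindex σ₄ (σ₂-inj ∘ rev-injective ∘ iterate-injective next next-injective 4))
                 (m≤m+n _ 0))))) ⟩
      5 * ∑ darts (χ ∘ tail)   ∎
      where
      open ≤-Reasoning
      σ₂ σ₃ σ₄ : Dart G → Dart G
      σ₂ e = iterate next (rev (next e)) 2
      σ₃ e = iterate next (rev (next e)) 3
      σ₄ e = iterate next (rev (σ₂ e)) 4
      σ₂-inj : ∀ {d e} → σ₂ d ≡ σ₂ e → d ≡ e
      σ₂-inj = next-injective ∘ rev-injective ∘ iterate-injective next next-injective 2
      reindex : ∀ (σ : Dart G → Dart G) → (∀ {d e} → σ d ≡ σ e → d ≡ e) →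
              ∑ darts (χ ∘ head ∘ σ) ≤ ∑ darts (χ ∘ tail)
      reindex σ inj = ∑-permute-≤ (rev ∘ σ) (χ ∘ tail) (inj ∘ rev-injective)

    τ≡0 : ∀ {d} → τ d ≡ 0 → Tri d
    τ≡0 {d} eq with tri? d
    ... | yes tri = tri
    ... | no _ = contradiction eq λ ()

    tri-or-τ : ∀ d → Tri d ⊎ 1 ≤ τ d
    tri-or-τ d with tri? d
    ... | yes tri = inj₁ tri
    ... | no _ = inj₂ ≤-refl

    -- The face consists of `rev e` and `next e`, so `next e` has the same ends as `e`. In a simple
    -- graph this means `next e ≡ e`, a rotation of period one.
    digon⇒deg≡1 : ∀ e → Digon (rev e) → deg (tail e) ≡ 1
    digon⇒deg≡1 e digon = sym (period≡deg e 0 (nonempty (∈-at e))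
      (dart-≡ (tail-next e) (trans (sym (tail-side e)) (cong tail digon))))
      where
      nonempty : ∀ {A : Set} {xs : List A} {x} → x ∈ xs → 1 ≤ length xs
      nonempty (here _)  = s≤s z≤n
      nonempty (there _) = s≤s z≤n

    share-≤6 : ∀ d → share d ≤ 6
    share-≤6 d with faceStep (faceStep d) ≟ᵈ d | faceStep (faceStep (faceStep d)) ≟ᵈ d
    ... | yes _ | _     = ≤-refl
    ... | no  _ | yes _ = s≤s (s≤s (s≤s (s≤s z≤n)))
    ... | no  _ | no  _ = s≤s (s≤s (s≤s z≤n))

    share+τ : ∀ d → ¬ Digon d → share d + τ d ≤ 4
    share+τ d ¬digon with faceStep (faceStep d) ≟ᵈ d | faceStep (faceStep (faceStep d)) ≟ᵈ d
    ... | yes p | _     = contradiction p ¬digon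
    ... | no  _ | yes q = +-monoʳ-≤ 4 (⟦⟧-≤ (¬? (tri? d)) (contradiction q))
    ... | no  _ | no  _ = +-monoʳ-≤ 3 (⟦⟧≤1 (¬? (tri? d)))

    -- The two corners beside `next e` are either both triangular, and then `degree-five-edge`
    -- forces a neighbour of degree at least 7, or one of them is counted by `τ`. Summed around the
    -- vertex, every corner occurs twice.
    pull-bad₅ : ∀ e → Bad₅ (tail e) → 1 ≤ pull (next e) + (τ (rev e) + τ (rev (next e)))
    pull-bad₅ e (¬good , deg5) with tri-or-τ (rev e) | tri-or-τ (rev (next e))
    ... | inj₂ 1≤ | _       = ≤-trans 1≤ (≤-trans (m≤m+n _ _) (m≤n+m _ (pull (next e))))
    ... | inj₁ _  | inj₂ 1≤ = ≤-trans 1≤ (≤-trans (m≤n+m _ (τ (rev e))) (m≤n+m _ (pull (next e))))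
    ... | inj₁ tri | inj₁ tri′ = ≤-trans (≤-reflexive (sym
      (⟦⟧-yes (bad₅? (tail (next e)) ×-dec 7 ≤? deg (head (next e))) (bad , heavy)))) (m≤m+n _ _)
      where
      bad : Bad₅ (tail (next e))
      bad = subst Bad₅ (sym (tail-next e)) (¬good , deg5)
      heavy : 7 ≤ deg (head (next e))
      heavy = ≰⇒> λ deg≤6 → proj₁ bad
        (degree-five-edge (next e) (proj₂ bad) (Tri-next tri) tri′ deg≤6)

    -- Two bad heads of degree 5 at a triangular corner are ruled out by `degree-five-pair`. Summed
    -- around the vertex, every transfer given occurs twice.
    pull-pair : ∀ e → pull (rev e) + pull (rev (next e)) ≤ 1 + τ (rev e)
    pull-pair e with tri-or-τ (rev e)
    ... | inj₂ 1≤ = ≤-trans (+-mono-≤ (⟦⟧≤1 (bad₅? _ ×-dec 7 ≤? _)) (⟦⟧≤1 (bad₅? _ ×-dec 7 ≤? _)))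
                      (s≤s 1≤)
    ... | inj₁ tri with bad₅? (head e) ×-dec 7 ≤? deg (tail e)
                      | bad₅? (head (next e)) ×-dec 7 ≤? deg (tail (next e))
    ... | no _ | p? = ≤-trans (⟦⟧≤1 p?) (s≤s z≤n)
    ... | yes _ | no _ = s≤s z≤n
    ... | yes ((¬good , deg5) , _) | yes ((_ , deg5′) , _) =
      contradiction (degree-five-pair e tri deg5 (≤-reflexive deg5′)) ¬good

    -- S and N run over the darts into v, one for each corner at v.
    module AtVertex (v : Fin n) where
      d In Out N S : ℕ
      d   = deg v
      In  = ∑ (at v) pull
      Out = ∑ (at v) (pull ∘ rev)
      N   = ∑ (at v) (τ ∘ rev)
      S   = ∑ (at v) (share ∘ rev)

      S≤ : S ≤ d * 6
      S≤ = ≤-trans (∑-mono (at v) λ _ → share-≤6 _) (≤-reflexive (∑-const 6 (at v)))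

      -- Degree at least 2 excludes digons, and on other faces a corner that is not triangular has
      -- share 3 instead of 4.
      S+N≤ : 2 ≤ d → S + N ≤ d * 4
      S+N≤ 2≤d = begin
        S + N                                      ≡⟨ ∑-+ (at v) _ _ ⟨
        ∑ (at v) (λ e → share (rev e) + τ (rev e)) ≤⟨ ∑-mono (at v) (λ e∈ → share+τ _ (¬digon e∈)) ⟩
        ∑ (at v) (λ _ → 4)                         ≡⟨ ∑-const 4 (at v) ⟩
        d * 4                                      ∎
        where
        open ≤-Reasoning
        ¬digon : ∀ {e} → e ∈ at v → ¬ Digon (rev e)
        ¬digon {e} e∈ digon = contradiction
          (≤-trans 2≤d (≤-reflexive (trans (cong deg (sym (∈-at⁻ e∈))) (digon⇒deg≡1 e digon)))) λ { (s≤s ()) }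

      In≥ : Bad₅ v → 5 ≤ In + (N + N)
      In≥ bad = begin
        5                                  ≡⟨ proj₂ bad ⟨
        d                                  ≡⟨ *-identityʳ d ⟨
        d * 1                              ≤⟨ ∑-≤const (at v) (λ {e} e∈ → pull-bad₅ e (subst Bad₅ (sym (∈-at⁻ e∈)) bad)) ⟩
        ∑ (at v) (λ e → pull (next e) + (τ (rev e) + τ (rev (next e))))
          ≡⟨ trans (∑-+ (at v) _ _) (cong (∑ (at v) (pull ∘ next) +_) (∑-+ (at v) _ _)) ⟩
        ∑ (at v) (pull ∘ next) + (N + ∑ (at v) (τ ∘ rev ∘ next))
          ≤⟨ +-mono-≤ (∑-next-≤ pull v) (+-monoʳ-≤ N (∑-next-≤ (τ ∘ rev) v)) ⟩
        In + (N + N) ∎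
        where open ≤-Reasoning

      Out≤ : Out + Out ≤ d + N
      Out≤ = begin
        Out + Out                                ≤⟨ +-monoʳ-≤ Out (∑-next-≥ (pull ∘ rev) v) ⟩
        Out + ∑ (at v) (pull ∘ rev ∘ next)       ≡⟨ ∑-+ (at v) _ _ ⟨
        ∑ (at v) (λ e → pull (rev e) + pull (rev (next e))) ≤⟨ ∑-mono (at v) (λ {e} _ → pull-pair e) ⟩
        ∑ (at v) (λ e → 1 + τ (rev e))           ≡⟨ ∑-+ (at v) (λ _ → 1) _ ⟩
        ∑ (at v) (λ _ → 1) + N                   ≡⟨ cong (_+ N) (trans (∑-const 1 (at v)) (*-identityʳ d)) ⟩
        d + N                                    ∎
        where open ≤-Reasoning

      Out≡0 : d ≤ 6 → Out ≡ 0
      Out≡0 d≤6 = trans (∑-cong (at v) λ {e} e∈ → ⟦⟧-no (bad₅? (head e) ×-dec 7 ≤? deg (tail e))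
          λ (_ , 7≤) → <⇒≱ 7≤ (≤-trans (≤-reflexive (cong deg (∈-at⁻ e∈))) d≤6))
        (trans (∑-const 0 (at v)) (*-zeroʳ d))

      ¬hex⇒N : d ≡ 6 → ¬ Hex v → 1 ≤ N
      ¬hex⇒N deg6 ¬hex = n≢0⇒n>0 λ N≡0 → ¬hex (deg6 , All.tabulate λ e∈ →
        τ≡0 (n≤0⇒n≡0 (≤-trans (∑-member (τ ∘ rev) e∈) (≤-reflexive N≡0))))

    χ≤1 : ∀ v → χ v ≤ 1
    χ≤1 v = ⟦⟧≤1 (¬? (hex? v) ×-dec ¬? (bad₅? v))

    module _ {U : ℕ} (41≤U : 41 ≤ U) (v : Fin n) where
      open AtVertex v
      open Arithmetic {d} {In} {Out} {N} {S} {χ v} {η v} {γ v} 41≤U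

      Balanced : Set
      Balanced = LHS ≤ RHS

      balanced : Balanced
      balanced with 7 ≤? d
      ... | yes 7≤d = heavy 7≤d (χ≤1 v) (S+N≤ (≤-trans numeric 7≤d)) Out≤
      ... | no 7≰d = light (s≤s⁻¹ (≰⇒> 7≰d)) (good? v)
        where
        bad : d ≤ 6 → ¬ Good v → Dec (d ≡ 5) → Dec (Hex v) → Balanced
        bad d≤6 ¬good (yes d≡5) _ = five d≡5 (Out≡0 d≤6)
          (⟦⟧-no (¬? (hex? v) ×-dec ¬? (bad₅? v)) λ (_ , ¬bad) → ¬bad (¬good , d≡5))
          (S+N≤ (≤-trans numeric (≤-reflexive (sym d≡5)))) (In≥ (¬good , d≡5))
        bad d≤6 ¬good (no _) (yes hex@(d≡6 , _)) = six-hex d≡6 (Out≡0 d≤6)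
          (⟦⟧-no (¬? (hex? v) ×-dec ¬? (bad₅? v)) λ (¬hex , _) → ¬hex hex)
          (⟦⟧-yes (hex? v ×-dec ¬? (good? v)) (hex , ¬good))
          (S+N≤ (≤-trans numeric (≤-reflexive (sym d≡6))))
        bad d≤6 ¬good (no d≢5) (no ¬hex) = six d≡6 (Out≡0 d≤6) (χ≤1 v) (¬hex⇒N d≡6 ¬hex)
          (S+N≤ (≤-trans numeric (≤-reflexive (sym d≡6))))
          where
          d≡6 : d ≡ 6
          d≡6 = ≤-antisym d≤6 (≤∧≢⇒< (≰⇒> (¬good ∘ deg≤4⇒good v)) (d≢5 ∘ sym))
        light : d ≤ 6 → Dec (Good v) → Balanced
        light d≤6 (yes good) = light-good (⟦⟧-yes (good? v) good) d≤6 (Out≡0 d≤6) (χ≤1 v) S≤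
        light d≤6 (no ¬good) = bad d≤6 ¬good (d ≟ 5) (hex? v)

    vertices : List (Fin n)
    vertices = allFin n

    at-sum : ∀ h → ∑ vertices (λ v → ∑ (at v) h) ≡ ∑ darts h
    at-sum h = sym (∑-concatMap at vertices h)

    deg-sum : ∀ f → ∑ vertices (λ v → deg v * f v) ≡ ∑ darts (f ∘ tail)
    deg-sum f = trans (∑-cong vertices λ {v} _ → trans (sym (∑-const (f v) (at v)))
        (∑-cong (at v) λ e∈ → cong f (sym (∈-at⁻ e∈)))) (at-sum (f ∘ tail))

    module _ (spherical : IsSpherical G R) where
      open AtVertex

      -- The sum of the inequalities at all vertices. Transfers cancel because `rev` permutes the
      -- darts, `euler-≤` bounds the term in `length darts`, and `∑η≤∑χ` covers the payments
      -- received; what survives is the constant 6 per vertex.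
      many-good : ∀ {U} → 41 ≤ U → 6 * n ≤ (48 * U + 36) * ∑ vertices γ
      many-good {U} 41≤U = +-cancelʳ-≤ K _ _ (begin
        6 * n + K
          ≡⟨ solve 5 (λ n u p x s → con 6 :* n :+ (u :* (con 48 :* n :+ con 2 :* p :+ con 4 :* s) :+ con 5 :* x) :=
                                    n :* con 6 :+ con 5 :* x :+ u :* (n :* con 48 :+ con 2 :* p :+ con 4 :* s))
               refl n U PR X SH ⟩
        n * 6 + 5 * X + U * (n * 48 + 2 * PR + 4 * SH)
          ≡⟨ lhs ⟨
        ∑ vertices (λ v → (6 + 5 * (deg v * χ v)) + U * (48 + 2 * Out v + 4 * S v))
          ≤⟨ ∑-mono vertices (λ {v} _ → balanced 41≤U v) ⟩
        ∑ vertices (λ v → U * (24 * deg v + 2 * In v + 48 * γ v) + (deg v * η v + 36 * γ v))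
          ≡⟨ rhs ⟩
        U * (24 * length darts + 2 * P + 48 * Γ) + (∑ darts (η ∘ tail) + 36 * Γ)
          ≤⟨ +-mono-≤ (*-monoʳ-≤ U (+-monoˡ-≤ (48 * Γ) (+-mono-≤ lengths
               (*-monoʳ-≤ 2 (∑-permute-≤ rev (pull ∘ rev) rev-injective))))) (+-monoˡ-≤ (36 * Γ) ∑η≤∑χ) ⟩
        U * (4 * (12 * n + SH) + 2 * PR + 48 * Γ) + (5 * X + 36 * Γ)
          ≡⟨ solve 6 (λ n u p x s g → u :* (con 4 :* (con 12 :* n :+ s) :+ con 2 :* p :+ con 48 :* g)
                 :+ (con 5 :* x :+ con 36 :* g) :=
                 (con 48 :* u :+ con 36) :* g :+ (u :* (con 48 :* n :+ con 2 :* p :+ con 4 :* s) :+ con 5 :* x))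
               refl n U PR X SH Γ ⟩
        (48 * U + 36) * Γ + K ∎)
        where
        open ≤-Reasoning
        open +-*-Solver
        P PR X SH Γ K : ℕ
        P  = ∑ darts pull
        PR = ∑ darts (pull ∘ rev)
        X  = ∑ darts (χ ∘ tail)
        SH = ∑ darts share
        Γ  = ∑ vertices γ
        K  = U * (48 * n + 2 * PR + 4 * SH) + 5 * X
        lengths : 24 * length darts ≤ 4 * (12 * n + SH)
        lengths = ≤-trans (≤-reflexive (*-assoc 4 6 (length darts))) (*-monoʳ-≤ 4 (euler-≤ spherical))
        linear : ∀ {f g : Fin n → ℕ} {a b} → ∑ vertices f ≡ a → ∑ vertices g ≡ b →
                 ∑ vertices (λ v → f v + g v) ≡ a + b
        linear {f} {g} eq eq′ = trans (∑-+ vertices f g) (cong₂ _+_ eq eq′)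
        scaled : ∀ c {f : Fin n → ℕ} {a} → ∑ vertices f ≡ a → ∑ vertices (λ v → c * f v) ≡ c * a
        scaled c {f} eq = trans (∑-* c vertices f) (cong (c *_) eq)
        constant : ∀ c → ∑ vertices (λ _ → c) ≡ n * c
        constant c = trans (∑-const c vertices) (cong (_* c) (length-allFin n))
        lhs : ∑ vertices (λ v → (6 + 5 * (deg v * χ v)) + U * (48 + 2 * Out v + 4 * S v)) ≡
              n * 6 + 5 * X + U * (n * 48 + 2 * PR + 4 * SH)
        lhs = linear (linear (constant 6) (scaled 5 (deg-sum χ)))
          (scaled U (linear (linear (constant 48) (scaled 2 (at-sum (pull ∘ rev))))
            (scaled 4 (trans (at-sum (share ∘ rev)) share-rev))))
          where
          share-rev : ∑ darts (share ∘ rev) ≡ SH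
          share-rev = ≤-antisym (∑-permute-≤ rev share rev-injective) (∑-permute-≤ rev (share ∘ rev) rev-injective)
        rhs : ∑ vertices (λ v → U * (24 * deg v + 2 * In v + 48 * γ v) + (deg v * η v + 36 * γ v)) ≡
              U * (24 * length darts + 2 * P + 48 * Γ) + (∑ darts (η ∘ tail) + 36 * Γ)
        rhs = linear (scaled U (linear (linear (scaled 24 degrees) (scaled 2 (at-sum pull))) (scaled 48 refl)))
          (linear (deg-sum η) (scaled 36 refl))
          where
          degrees : ∑ vertices deg ≡ length darts
          degrees = trans (∑-cong vertices λ _ → sym (*-identityʳ _))
            (trans (deg-sum (λ _ → 1)) (trans (∑-const 1 darts) (*-identityʳ _)))

  -- Conclusion for planar graphs

  module _ {n} (G : Graph n) where

    saves≥1 : 2 ≤ n → ∀ v → 1 ≤ s G v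
    saves≥1 (s≤s (s≤s _)) zero    = saves-one G zero {suc zero} λ ()
    saves≥1 (s≤s (s≤s _)) (suc v) = saves-one G (suc v) {zero} λ ()

    total-saved : 2 ≤ n → Planar G → n * n ≤ 2712 * ∑ (allFin n) (s G)
    total-saved 2≤n (R , spherical) = split (8 ≤? n)
      where
      open Embedding R
      saved : ∀ v (p : Dec (Good v)) → (n ∸ 6) * ⟦ p ⟧ ≤ s G v
      saved v (yes good) = subst (_≤ s G v) (sym (*-identityʳ (n ∸ 6))) (m≤n+o⇒m∸n≤o n 6 good)
      saved v (no _)     = subst (_≤ s G v) (sym (*-zeroʳ (n ∸ 6))) z≤n
      split : Dec (8 ≤ n) → n * n ≤ 2712 * ∑ (allFin n) (s G)
      split (no 8≰n)  = sum-if-small (s G) (s≤s⁻¹ (≰⇒> 8≰n)) (saves≥1 2≤n)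
      -- `U = 50` produces the coefficient `48 * 50 + 36` that `sum-if-large` expects.
      split (yes 8≤n) = sum-if-large (s G) γ 8≤n (many-good spherical (numeric {41} {50})) λ v → saved v (good? v)

open import Data.Integer.Base using (+_)
open import Data.Rational.Base using (_/_; _≤_)

theorem3 : ∀ (n : ℕ) .{{_ : NonTrivial n}} (G : Graph n) → Planar G →
    + 1 / 2712 ≤ survivingRate {{nonTrivial⇒nonZero n}} G
theorem3 n@(suc (suc m)) G planar = toℚᵘ-cancel-≤
  -- Unnormalised fractions are compared by cross-multiplication; `mkℚᵘ` takes the denominator minus
  -- one, whence 2711 and `pred (n ^ 2)`.
  (ℚᵘ.≤-respˡ-≃ (ℚᵘ.≃-sym (toℚᵘ-fromℚᵘ (ℚᵘ.mkℚᵘ (+ 1) 2711)))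
    (ℚᵘ.≤-respʳ-≃ (ℚᵘ.≃-sym (toℚᵘ-fromℚᵘ (ℚᵘ.mkℚᵘ (+ sum (s G)) (pred (n ^ 2)))))
      (ℚᵘ.*≤* (subst₂ ℤ._≤_ (ℤ.pos-* 1 (n ^ 2)) (ℤ.pos-* (sum (s G)) 2712)
        (ℤ.+≤+ (rate-bound (suc m) (s G) (total-saved G (s≤s (s≤s z≤n)) planar)))))))
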